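{- Let $t\ge7$ be an odd integer. Then $$\lim_{r\to\infty}\pi_{rt}(rC_t)=\frac12,$$ where $C_t$ is the cycle on $t$ vertices.
   Context: Graphs are finite and simple. An $m$-partite graph $G$ is a graph with a vertex partition $V = V_1\sqcup\dots\sqcup V_m$ into nonempty parts such that no edge has both ends in the same part. For disjoint nonempty vertex sets $X,Y$, the edge density is $d(X,Y) = \frac{e(X,Y)}{|X||Y|}$, where $e(X,Y)$ is the number of edges between $X$ and $Y$. The $m$-partite density of $G$ is $d_m(G) = \min_{1\le i<j\le m} d(V_i,V_j)$. A traversal of $G$ is a subgraph (on $m$ vertices) containing exactly one vertex from each part. For a graph $F$, $G$ contains an $F$-traversal if some traversal of $G$ contains $F$ as a subgraph (up to isomorphism). The critical density is $$\pi_m(F) = \sup\{\alpha\in[0,1] : \text{there exists an } m\text{ -partite graph } G \text{ with } d_m(G)\ge\alpha \text{ and no } F\text{ -traversal}\}.$$ $rC_t$ denotes the graph consisting of $r$ vertex-disjoint copies of $C_t$. -}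

module Defs where

open import Data.Fin using (Fin; toℕ; remQuot; _<?_)
open import Data.Fin.Properties using (_≟_)
open import Data.Fin.Subset using (Subset; _∈_; ∣_∣; Nonempty)
open import Data.Fin.Subset.Properties using (_∈?_; x∈⁅y⁆⇒x≡y; p⊆q⇒∣p∣≤∣q∣; ∣⁅x⁆∣≡1)
open import Data.Integer using (+_)
open import Data.List using (List; allFin; cartesianProduct; filter; length; map)
open import Data.Nat as ℕ using (ℕ; suc; NonZero)
import Data.Nat.Properties as ℕ
open import Data.Product using (_×_; _,_; proj₁; proj₂; ∃; ∃!)
open import Data.Rational using (ℚ; 0ℚ; 1ℚ; _/_; _≤_; _<_; _+_; _-_)
import Data.Rational.Properties as ℚ
open import Data.Sum using (_⊎_; inj₁; inj₂; swap)
open import Data.Vec using (tabulate)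
open import Data.Vec.Properties using (lookup∘tabulate; lookup⇒[]=)
open import Function.Definitions using (Injective)
open import Level using (0ℓ) renaming (suc to lsuc)
open import Relation.Binary using (DecTotalOrder; Rel; Symmetric; Irreflexive; Decidable)
open import Relation.Binary.PropositionalEquality using (_≡_; refl; sym; trans; subst)
open import Relation.Nullary using (¬_; does)
open import Relation.Nullary.Decidable using (_×-dec_; _⊎-dec_; dec-true)
open import Data.List.Extrema (DecTotalOrder.totalOrder ℚ.≤-decTotalOrder) using (min)

record Graph (n : ℕ) : Set₁ where
  field
    Adj    : Rel (Fin n) 0ℓ
    adj?   : Decidable Adj
    symm   : Symmetric Adj
    irrefl : Irreflexive _≡_ Adj

-- Each edge between X and Y is counted once provided X and Y are disjoint.
edgesBetween : ∀ {n} → Graph n → Subset n → Subset n → ℕ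
edgesBetween {n} G X Y =
  length (filter (λ p → (proj₁ p ∈? X) ×-dec ((proj₂ p ∈? Y) ×-dec adj? (proj₁ p) (proj₂ p)))
                 (cartesianProduct (allFin n) (allFin n)))
  where open Graph G

nonempty⇒size≢0 : ∀ {n} {X : Subset n} → Nonempty X → NonZero ∣ X ∣
nonempty⇒size≢0 {X = X} (x , x∈X) =
  ℕ.>-nonZero (subst (ℕ._≤ ∣ X ∣) (∣⁅x⁆∣≡1 x) (p⊆q⇒∣p∣≤∣q∣ λ y∈⁅x⁆ →
    subst (_∈ X) (sym (x∈⁅y⁆⇒x≡y x y∈⁅x⁆)) x∈X))

density : ∀ {n} → Graph n → (X Y : Subset n) → Nonempty X → Nonempty Y → ℚ
density G X Y X≢∅ Y≢∅ = (+ edgesBetween G X Y / (∣ X ∣ ℕ.* ∣ Y ∣))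
  {{ℕ.m*n≢0 ∣ X ∣ ∣ Y ∣ {{nonempty⇒size≢0 X≢∅}} {{nonempty⇒size≢0 Y≢∅}}}}

-- The partition V₁ ⊔ … ⊔ Vₘ is given by the map sending a vertex to the
-- index of its part.
record PartiteGraph (m : ℕ) : Set₁ where
  field
    order       : ℕ
    graph       : Graph order
    partOf      : Fin order → Fin m
    nonempty    : ∀ i → ∃ λ v → partOf v ≡ i
    independent : ∀ {u v} → Graph.Adj graph u v → ¬ partOf u ≡ partOf v

  open Graph graph public

  part : Fin m → Subset order
  part i = tabulate (λ v → does (partOf v ≟ i))

  part-nonempty : ∀ i → Nonempty (part i)
  part-nonempty i with nonempty i
  ... | v , v∈Vᵢ = v , lookup⇒[]= v (part i)
    (trans (lookup∘tabulate _ v) (dec-true (partOf v ≟ i) v∈Vᵢ))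

indexPairs : ∀ m → List (Fin m × Fin m)
indexPairs m = filter (λ p → proj₁ p <? proj₂ p) (cartesianProduct (allFin m) (allFin m))

-- `min 1ℚ xs` is the least element of 1ℚ ∷ xs.  Densities never exceed 1, so
-- for m ≥ 2 this is the minimum over the pairs i < j; for m ≤ 1, where there
-- are no pairs, it is 1 by convention.
partiteDensity : ∀ {m} → PartiteGraph m → ℚ
partiteDensity {m} G =
  min 1ℚ (map (λ p → density graph (part (proj₁ p)) (part (proj₂ p))
                       (part-nonempty (proj₁ p)) (part-nonempty (proj₂ p)))
              (indexPairs m))
  where open PartiteGraph G

record Subgraph {n : ℕ} (G : Graph n) : Set₁ where
  field
    vertices : Subset n
    edges    : Graph n
    within   : ∀ {u v} → Graph.Adj edges u v → u ∈ vertices × v ∈ vertices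
    included : ∀ {u v} → Graph.Adj edges u v → Graph.Adj G u v

IsTraversal : ∀ {m} (G : PartiteGraph m) → Subgraph (PartiteGraph.graph G) → Set
IsTraversal G T = ∀ i → ∃! _≡_ λ v → v ∈ Subgraph.vertices T × PartiteGraph.partOf G v ≡ i

-- An isomorphism of F with some subgraph of T is the same thing as an
-- injective, adjacency-preserving map from F to T.
Contains : ∀ {k n} {G : Graph n} → Graph k → Subgraph G → Set
Contains F T = ∃ λ f →
  Injective _≡_ _≡_ f ×
  (∀ x → f x ∈ vertices) ×
  (∀ {x y} → Graph.Adj F x y → Graph.Adj edges (f x) (f y))
  where open Subgraph T

HasTraversal : ∀ {k m} → Graph k → PartiteGraph m → Set₁
HasTraversal F G = ∃ λ T → IsTraversal G T × Contains F T

-- A real number is presented by the rationals strictly below it and the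
-- rationals strictly above it.
record Cut ℓ : Set (lsuc ℓ) where
  field
    Below : ℚ → Set ℓ
    Above : ℚ → Set ℓ

-- For a nonempty bounded set A these are, classically, exactly the rationals
-- q < sup A and q > sup A.  Locatedness of the cut is not claimed.
sup : ∀ {ℓ} → (ℚ → Set ℓ) → Cut ℓ
sup A = record
  { Below = λ q → ∃ λ a → A a × q < a
  ; Above = λ q → ∃ λ u → (∀ a → A a → a ≤ u) × u < q
  }

-- |xₙ - l| < ε is l - ε < xₙ < l + ε.
_⟶_ : ∀ {ℓ} → (ℕ → Cut ℓ) → ℚ → Set ℓ
x ⟶ l = ∀ ε → 0ℚ < ε → ∃ λ N → ∀ n → N ℕ.≤ n →
  Cut.Below (x n) (l - ε) × Cut.Above (x n) (l + ε)

infix 4 _⟶_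

-- Restricting α to rationals does not change the supremum: all m-partite
-- densities are rational, and the set is downward closed in [0,1].
π : ∀ {k} → ℕ → Graph k → Cut (lsuc 0ℓ)
π m F = sup λ α → 0ℚ ≤ α × α ≤ 1ℚ ×
  ∃ λ (G : PartiteGraph m) → α ≤ partiteDensity G × ¬ HasTraversal F G

Next : ∀ {t} → Fin t → Fin t → Set
Next {t} i j = toℕ j ≡ suc (toℕ i) ⊎ (suc (toℕ i) ≡ t × toℕ j ≡ 0)

next? : ∀ {t} → Decidable (Next {t})
next? {t} i j =
  (toℕ j ℕ.≟ suc (toℕ i)) ⊎-dec ((suc (toℕ i) ℕ.≟ t) ×-dec (toℕ j ℕ.≟ 0))

next-irrefl : ∀ {t} → 3 ℕ.≤ t → (i : Fin t) → ¬ Next i i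
next-irrefl 3≤t i (inj₁ i≡1+i) = ℕ.1+n≢n (sym i≡1+i)
next-irrefl 3≤t i (inj₂ (1+i≡t , i≡0)) with toℕ i
next-irrefl (ℕ.s≤s ()) i (inj₂ (refl , refl)) | .0

cycle : ∀ t → 3 ℕ.≤ t → Graph t
cycle t 3≤t = record
  { Adj    = λ i j → Next i j ⊎ Next j i
  ; adj?   = λ i j → next? i j ⊎-dec next? j i
  ; symm   = swap
  ; irrefl = λ { {i} refl (inj₁ n) → next-irrefl 3≤t i n
               ; {i} refl (inj₂ n) → next-irrefl 3≤t i n }
  }

-- Vertex i of copy c is the element c * k + i of Fin (r * k).
copies : ∀ {k} r → Graph k → Graph (r ℕ.* k)
copies {k} r F = record
  { Adj    = λ u v → copyOf u ≡ copyOf v × Adj (vertexOf u) (vertexOf v)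
  ; adj?   = λ u v → (copyOf u ≟ copyOf v) ×-dec adj? (vertexOf u) (vertexOf v)
  ; symm   = λ (c , a) → sym c , symm a
  ; irrefl = λ { refl (_ , a) → irrefl refl a }
  }
  where
  open Graph F
  copyOf : Fin (r ℕ.* k) → Fin r
  copyOf u = proj₁ (remQuot k u)
  vertexOf : Fin (r ℕ.* k) → Fin k
  vertexOf u = proj₂ (remQuot {r} k u)

{-# OPTIONS --safe #-}
module Submission where

-- The complete bipartite pattern shows π ≥ ½.  Conversely, suppose that all
-- densities exceed ½ + 1/(2D), and weight the vertices so that every part has
-- the same total weight.  Given a part i and sufficiently many other parts,
-- some vertex v of part i has a neighbourhood X of at least half the total
-- weight of those parts.  Delete vertices from the bipartite incidence X × V
-- until what is left, L × A, has large minimum degree.  If some edge joins two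
-- vertices of A, it extends on both sides to paths alternating between A and
-- L ⊆ X, and v closes such a path to a cycle of any odd length ≥ 5; vertices in
-- new parts are available at each step because the degrees are large.  If A is
-- independent, the edge density is at most ½ up to an error, a contradiction.
--
-- So every part lies on a transversal C_t inside any large enough set of
-- parts.  By Ramsey's theorem there is therefore a large set R of parts all of
-- whose t-subsets carry a transversal C_t.  Cover the parts outside R greedily,
-- using parts of R only for the last boundedly many, and cut up what remains
-- of R arbitrarily.

open import Defs
open import Data.Bool using (Bool; true; false; _∧_; not; if_then_else_)
import Data.Bool.Properties as Bool
open import Data.Fin as Fin using (Fin; zero; suc; toℕ; fromℕ<; combine; remQuot; punchOut; splitAt; _↑ˡ_; _↑ʳ_)
open import Data.Fin.Properties using (_≟_; any?; all?; toℕ-fromℕ<; toℕ<n; remQuot-combine;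
  punchOut-injective; injective⇒≤; <-cmp; splitAt-↑ˡ; splitAt-↑ʳ)
open import Data.Fin.Subset using (Subset; ∣_∣; _∈_)
open import Data.Fin.Subset.Properties using (_∈?_)
open import Data.Integer as ℤ using (+[1+_]; -[1+_])
import Data.Integer.Properties as ℤ
open import Data.List as List using (List; []; _∷_; _++_; length; take; drop; lookup; applyUpTo; allFin;
  filter; cartesianProduct; map)
open import Data.List.Membership.Propositional using (_∉_) renaming (_∈_ to _∈ˡ_)
open import Data.List.Membership.Propositional.Properties using (∈-applyUpTo⁺; ∈-applyUpTo⁻; ∈-∃++;
  ∈-lookup; ∈-++⁺ˡ; ∈-++⁺ʳ; ∈-++⁻; ∈-allFin; ∈-map⁺; ∈-filter⁺; ∈-filter⁻; ∈-cartesianProduct⁺)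
open import Data.List.Properties using (length-++; length-take; take++drop≡id; ++-assoc;
  length-applyUpTo; length-tabulate; filter-++; map-tabulate)
open import Data.List.Relation.Binary.Permutation.Propositional as ↭
  using (_↭_; prep; swap; ↭-sym; ↭-trans; ↭-refl; ↭-reflexive; ↭⇒↭ₛ; module PermutationReasoning)
open import Data.List.Relation.Binary.Permutation.Propositional.Properties
  using (↭-length; ↭-empty-inv; ++⁺ˡ; ++⁺ʳ; shift; shifts; ∈-resp-↭; All-resp-↭)
import Data.List.Relation.Binary.Permutation.Setoid.Properties as SetoidPerm
open import Data.List.Relation.Binary.Sublist.Propositional
  using (_⊆_; []; _∷_; _∷ʳ_; minimum; ⊆-refl; ⊆-trans)
open import Data.List.Relation.Binary.Sublist.Propositional.Properties using (All-resp-⊆; take-⊆)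
import Data.List.Relation.Binary.Sublist.Propositional.Properties as Sub
open import Data.List.Relation.Unary.All as All using (All; []; _∷_)
import Data.List.Relation.Unary.All.Properties as All
open import Data.List.Relation.Unary.Any using (here; there)
open import Data.List.Relation.Unary.Unique.Propositional using (Unique; []; _∷_)
import Data.List.Relation.Unary.Unique.Propositional.Properties as Unique
open import Data.Nat as ℕ using (ℕ; zero; suc; _+_; _*_; _!; _≤_; _<_; z≤n; s≤s; z<s; _≤?_; NonZero)
open import Data.Nat.Divisibility using (_∣_; _∤_; divides; ∣-trans; ∣-refl; ∣-reflexive; ∣m+n∣m⇒∣n;
  ∣m∣n⇒∣m+n; m≤n⇒m!∣n!; m∣m*n)
open import Data.Nat.Properties hiding (_≟_; <-cmp)
open import Data.Nat.Tactic.RingSolver using (solve-∀)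
open import Data.Product using (_×_; _,_; proj₁; proj₂; ∃; ∃₂; ∃-syntax; Σ-syntax)
open import Data.Rational as ℚ using (ℚ; mkℚ; ½; 0ℚ; 1ℚ)
import Data.Rational.Properties as ℚ
open import Data.Rational.Unnormalised using (mkℚᵘ; *≤*; *<*)
import Data.Rational.Unnormalised.Properties as ℚᵘ
open import Data.Sum using (_⊎_; inj₁; inj₂; [_,_]′)
open import Data.Unit using (tt)
open import Data.Vec as Vec using (Vec; []; _∷_; tabulate)
open import Data.Vec.Properties using (lookup∘tabulate; lookup⇒[]=; []=⇒lookup)
open import Function using (_∘_; id; flip; mk⇔)
open import Function.Definitions using (Injective)
open import Level using (0ℓ)
open import Relation.Binary using (DecTotalOrder; DecidableEquality; tri<; tri≈; tri>)
open import Relation.Binary.PropositionalEquality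
  using (_≡_; _≢_; refl; cong; cong₂; sym; trans; subst; subst₂; ≢-sym; setoid; module ≡-Reasoning)
open import Relation.Nullary using (¬_; Dec; yes; no; does; contradiction)
open import Relation.Nullary.Decidable using (_×-dec_; _→-dec_; ¬?; dec-true; dec-false; does-⇔; map′; toWitness)
open import Relation.Unary using (Pred; Decidable; ∁)
open import Algebra.Properties.Semiring.Sum +-*-semiring
  using (sum; sum-cong-≗; ∑-distrib-+; ∑-comm; *-distribˡ-sum; *-distribʳ-sum; sum-syntax)
open import Data.List.Extrema (DecTotalOrder.totalOrder ℚ.≤-decTotalOrder) using (min≤xs; v≤min⁺)

private variable
  n : ℕ
  Elem : Set

-- Ramsey's theorem for k-uniform hypergraphs

-- A set of size k is encoded as a sublist of length k, so `P` is only tested on lists in the order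
-- inherited from `xs`.
Homogeneous : ℕ → Pred (List Elem) 0ℓ → List Elem → Set
Homogeneous k P xs = ∀ {l} → l ⊆ xs → length l ≡ k → P l

-- Opaque, since Agda would otherwise try to compute Ramsey numbers.
opaque

  ramseyNumber : ℕ → ℕ → ℕ → ℕ
  ramseyNumber zero    a       b       = a + b
  ramseyNumber (suc k) zero    b       = 0
  ramseyNumber (suc k) (suc a) zero    = 0
  ramseyNumber (suc k) (suc a) (suc b) =
    suc (ramseyNumber k (ramseyNumber (suc k) a (suc b)) (ramseyNumber (suc k) (suc a) b))

Homogeneous-∷ : ∀ {k} {P : Pred (List Elem) 0ℓ} {x xs} → Homogeneous k (λ l → P (x ∷ l)) xs →
                Homogeneous (suc k) P xs → Homogeneous (suc k) P (x ∷ xs)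
Homogeneous-∷ with-x without-x (_ ∷ʳ l⊆xs)    len = without-x l⊆xs len
Homogeneous-∷ with-x without-x (refl ∷ l⊆xs) len = with-x l⊆xs (suc-injective len)

take-homogeneous : ∀ {P : Pred (List Elem) 0ℓ} a xs → P [] → a ≤ length xs →
                   ∃[ ys ] ys ⊆ xs × length ys ≡ a × Homogeneous 0 P ys
take-homogeneous a xs P[] a≤ = take a xs , take-⊆ a xs ,
  trans (length-take a xs) (m≤n⇒m⊓n≡m a≤) , λ { {[]} _ _ → P[] }

Ramsey : ℕ → Pred (List Elem) 0ℓ → ℕ → ℕ → List Elem → Set
Ramsey k P a b xs =
  (∃[ ys ] ys ⊆ xs × length ys ≡ a × Homogeneous k P ys) ⊎
  (∃[ ys ] ys ⊆ xs × length ys ≡ b × Homogeneous k (∁ P) ys)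

-- The vertex `x` colours each k-set `l` by the colour of `x ∷ l`. On a set homogeneous for this
-- colouring, induction with `a` or `b` lowered by one gives either what is sought or a set that `x`
-- enlarges by one.
ramsey-∷ : ∀ {k a b N₁ N₂ x xs} {P : Pred (List Elem) 0ℓ} →
           Ramsey k (λ l → P (x ∷ l)) N₁ N₂ xs →
           (∀ ys → N₁ ≤ length ys → Ramsey (suc k) P a (suc b) ys) →
           (∀ ys → N₂ ≤ length ys → Ramsey (suc k) P (suc a) b ys) →
           Ramsey (suc k) P (suc a) (suc b) (x ∷ xs)
ramsey-∷ {x = x} (inj₁ (ys , ys⊆xs , len , hom)) red blue with red ys (≤-reflexive (sym len))
... | inj₁ (zs , zs⊆ys , len′ , hom′) = inj₁
      (x ∷ zs , refl ∷ ⊆-trans zs⊆ys ys⊆xs , cong suc len′ ,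
       Homogeneous-∷ (λ l⊆zs → hom (⊆-trans l⊆zs zs⊆ys)) hom′)
... | inj₂ (zs , zs⊆ys , rest) = inj₂ (zs , x ∷ʳ ⊆-trans zs⊆ys ys⊆xs , rest)
ramsey-∷ {x = x} (inj₂ (ys , ys⊆xs , len , hom)) red blue with blue ys (≤-reflexive (sym len))
... | inj₁ (zs , zs⊆ys , rest) = inj₁ (zs , x ∷ʳ ⊆-trans zs⊆ys ys⊆xs , rest)
... | inj₂ (zs , zs⊆ys , len′ , hom′) = inj₂
      (x ∷ zs , refl ∷ ⊆-trans zs⊆ys ys⊆xs , cong suc len′ ,
       Homogeneous-∷ (λ l⊆zs → hom (⊆-trans l⊆zs zs⊆ys)) hom′)

opaque
  unfolding ramseyNumber

  ramsey : ∀ k a b {P : Pred (List Elem) 0ℓ} → Decidable P → ∀ xs → ramseyNumber k a b ≤ length xs →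
           Ramsey k P a b xs
  -- The only 0-set is empty, so the colour of `[]` decides between the two outcomes.
  ramsey zero a b P? xs R≤ with P? []
  ... | yes P[] = inj₁ (take-homogeneous a xs P[] (≤-trans (m≤m+n a b) R≤))
  ... | no ¬P[] = inj₂ (take-homogeneous b xs ¬P[] (≤-trans (m≤n+m b a) R≤))
  ramsey (suc k) zero    b    P? xs R≤ = inj₁ ([] , minimum xs , refl , λ { [] () })
  ramsey (suc k) (suc a) zero P? xs R≤ = inj₂ ([] , minimum xs , refl , λ { [] () })
  ramsey (suc k) (suc a) (suc b) P? (x ∷ xs) (s≤s R≤) =
    ramsey-∷ (ramsey k _ _ (λ l → P? (x ∷ l)) xs R≤)
             (ramsey (suc k) a (suc b) P?) (ramsey (suc k) (suc a) b P?)

-- Packing a list by blocks of constant length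

-- Homogeneity speaks of sublists, whereas blocks are obtained only up to permutation; this passes
-- from one to the other.
⊆-resp-↭ʳ : {l xs ys : List Elem} → l ⊆ xs → xs ↭ ys → ∃[ l′ ] l′ ⊆ ys × l ↭ l′
⊆-resp-↭ʳ s                           ↭.refl           = _ , s , ↭-refl
⊆-resp-↭ʳ (x ∷ʳ s)                    (prep .x p)      with ⊆-resp-↭ʳ s p
... | l′ , s′ , q = l′ , x ∷ʳ s′ , q
⊆-resp-↭ʳ (refl ∷ s)                (prep x p)       with ⊆-resp-↭ʳ s p
... | l′ , s′ , q = x ∷ l′ , refl ∷ s′ , prep x q
⊆-resp-↭ʳ (x ∷ʳ (y ∷ʳ s))             (swap .x .y p)   with ⊆-resp-↭ʳ s p
... | l′ , s′ , q = l′ , y ∷ʳ (x ∷ʳ s′) , q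
⊆-resp-↭ʳ (x ∷ʳ (refl ∷ s))         (swap .x y p)    with ⊆-resp-↭ʳ s p
... | l′ , s′ , q = y ∷ l′ , refl ∷ (x ∷ʳ s′) , prep y q
⊆-resp-↭ʳ (refl ∷ (y ∷ʳ s))         (swap x .y p)    with ⊆-resp-↭ʳ s p
... | l′ , s′ , q = x ∷ l′ , y ∷ʳ (refl ∷ s′) , prep x q
⊆-resp-↭ʳ (refl ∷ (refl ∷ s))     (swap x y p)     with ⊆-resp-↭ʳ s p
... | l′ , s′ , q = y ∷ x ∷ l′ , refl ∷ (refl ∷ s′) , swap x y q
⊆-resp-↭ʳ s                           (↭.trans p₁ p₂)    with ⊆-resp-↭ʳ s p₁
... | l₁ , s₁ , q₁ with ⊆-resp-↭ʳ s₁ p₂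
...   | l₂ , s₂ , q₂ = l₂ , s₂ , ↭-trans q₁ q₂

⊆-complement : {xs ys : List Elem} → ys ⊆ xs → ∃[ zs ] xs ↭ zs ++ ys
⊆-complement []                   = [] , ↭-refl
⊆-complement (x ∷ʳ s)             with ⊆-complement s
... | zs , p = x ∷ zs , prep x p
⊆-complement (_∷_ {x} refl s)   with ⊆-complement s
... | zs , p = zs , ↭-trans (prep x p) (↭-sym (shift x zs _))

Unique-resp-⊇ : {xs ys : List Elem} → ys ⊆ xs → Unique xs → Unique ys
Unique-resp-⊇ []             _        = []
Unique-resp-⊇ (x ∷ʳ s)       (_ ∷ u)  = Unique-resp-⊇ s u
Unique-resp-⊇ (refl ∷ s)   (x∉ ∷ u) = All-resp-⊆ s x∉ ∷ Unique-resp-⊇ s u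

Unique-resp-↭ : {xs ys : List Elem} → xs ↭ ys → Unique xs → Unique ys
Unique-resp-↭ p = SetoidPerm.Unique-resp-↭ (setoid _) (↭⇒↭ₛ p)

data Packable (P : Pred (List Elem) 0ℓ) : List Elem → Set where
  none : Packable P []
  pack : ∀ {l xs zs} → P l → Packable P xs → zs ↭ l ++ xs → Packable P zs

Packable-resp-↭ : ∀ {P : Pred (List Elem) 0ℓ} {xs ys} → xs ↭ ys → Packable P xs → Packable P ys
Packable-resp-↭ p none = subst (Packable _) (sym (↭-empty-inv (↭-sym p))) none
Packable-resp-↭ p (pack Pl rest q) = pack Pl rest (↭-trans (↭-sym p) q)

-- Blocks have length `suc t`: a first element and `t` others. The hypothesis `extend` is the input
-- from graph theory: every element lies in a block whose other members come from any `M` further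
-- distinct elements.
module Packing
  {t M : ℕ} {P : Pred (List Elem) 0ℓ}
  (P-resp-↭ : ∀ {xs ys} → xs ↭ ys → P xs → P ys)
  (extend : ∀ {i S} → Unique (i ∷ S) → length S ≡ M →
            ∃₂ λ a b → S ↭ a ++ b × length a ≡ t × P (i ∷ a))
  where

  extend-≤ : ∀ {i S} → Unique (i ∷ S) → M ≤ length S →
             ∃₂ λ a b → S ↭ a ++ b × length a ≡ t × P (i ∷ a)
  extend-≤ {i} {S} u M≤ with extend {i} {take M S} (Unique-resp-⊇ (refl ∷ take-⊆ M S) u)
                                (trans (length-take M S) (m≤n⇒m⊓n≡m M≤))
  ... | a , b , p , len , Pia = a , b ++ drop M S , p′ , len , Pia
    where
    p′ : S ↭ a ++ b ++ drop M S
    p′ = begin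
      S                      ≡⟨ take++drop≡id M S ⟨
      take M S ++ drop M S   ↭⟨ ++⁺ʳ (drop M S) p ⟩
      (a ++ b) ++ drop M S   ≡⟨ ++-assoc a b (drop M S) ⟩
      a ++ b ++ drop M S     ∎
      where open PermutationReasoning

  -- Unlike `Homogeneous`, this does not depend on the order of `R`, so it survives the removal of
  -- elements that are split off only up to permutation.
  Reservoir : List Elem → Set
  Reservoir R = ∀ {l s} → R ↭ l ++ s → length l ≡ suc t → P l

  Homogeneous⇒Reservoir : ∀ {R} → Homogeneous (suc t) P R → Reservoir R
  Homogeneous⇒Reservoir hom {l} {s} p len with ⊆-resp-↭ʳ (Sub.++⁺ʳ s ⊆-refl) (↭-sym p)
  ... | l′ , l′⊆R , q = P-resp-↭ (↭-sym q) (hom l′⊆R (trans (sym (↭-length q)) len))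

  Reservoir-++ʳ : ∀ {R a R′} → R ↭ a ++ R′ → Reservoir R → Reservoir R′
  Reservoir-++ʳ {R} {a} {R′} p res {l} {s} q = res (begin
    R              ↭⟨ p ⟩
    a ++ R′        ↭⟨ ++⁺ˡ a q ⟩
    a ++ l ++ s    ↭⟨ shifts a l ⟩
    l ++ a ++ s    ∎)
    where open PermutationReasoning

  chop : ∀ q R → length R ≡ q * suc t → Reservoir R → Packable P R
  chop zero    []      _   res = none
  chop (suc q) R       len res = pack (res R↭ len-take) (chop q (drop (suc t) R) len-drop
                                        (Reservoir-++ʳ R↭ res)) R↭
    where
    R↭ : R ↭ take (suc t) R ++ drop (suc t) R
    R↭ = ↭-reflexive (sym (take++drop≡id (suc t) R))
    len-take : length (take (suc t) R) ≡ suc t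
    len-take = trans (length-take (suc t) R)
      (m≤n⇒m⊓n≡m (≤-trans (m≤m+n (suc t) (q * suc t)) (≤-reflexive (sym len))))
    len-drop : length (drop (suc t) R) ≡ q * suc t
    len-drop = +-cancelˡ-≡ (suc t) _ _ (begin
      suc t + length (drop (suc t) R)                        ≡⟨ cong (_+ length (drop (suc t) R)) len-take ⟨
      length (take (suc t) R) + length (drop (suc t) R)      ≡⟨ length-++ (take (suc t) R) ⟨
      length (take (suc t) R ++ drop (suc t) R)              ≡⟨ ↭-length R↭ ⟨
      length R                                               ≡⟨ len ⟩
      suc t + q * suc t                                      ∎)
      where open ≡-Reasoning

  ∣-length-drop : ∀ {a zs xs : List Elem} → zs ↭ a ++ xs → length a ≡ suc t →
                  suc t ∣ length zs → suc t ∣ length xs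
  ∣-length-drop {a} {zs} {xs} p len t∣ = ∣m+n∣m⇒∣n
    (subst (suc t ∣_) (trans (↭-length p) (length-++ a)) t∣) (∣-reflexive (sym len))

  -- Every element outside `R` is placed in a block with `t` elements of `R`, and the assumed length
  -- leaves at least `M` of them at each such step. Divisibility then lets `chop` cut up the rest of
  -- `R`.
  absorb : ∀ xs R → Unique (xs ++ R) → Reservoir R → M + t * length xs ≤ length R →
           suc t ∣ length (xs ++ R) → Packable P (xs ++ R)
  absorb []       R _ res _  (divides q len) = chop q R len res
  absorb (i ∷ xs) R u res M≤ t∣ with extend-≤ {i} {R} (Unique-resp-⊇ (refl ∷ Sub.++⁺ˡ xs ⊆-refl) u)
                                                (≤-trans (m≤m+n M _) M≤)
  ... | a , R′ , p , len , Pia = pack Pia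
      (absorb xs R′ (Unique-resp-⊇ (Sub.++⁺ˡ (i ∷ a) ⊆-refl) (Unique-resp-↭ zs↭ u))
              (Reservoir-++ʳ p res) remaining (∣-length-drop {i ∷ a} zs↭ (cong suc len) t∣))
      zs↭
    where
    zs↭ : i ∷ xs ++ R ↭ (i ∷ a) ++ xs ++ R′
    zs↭ = prep i (↭-trans (++⁺ˡ xs p) (shifts xs a))
    remaining : M + t * length xs ≤ length R′
    remaining = +-cancelˡ-≤ t _ _ (begin
      t + (M + t * length xs)   ≡⟨ peel-one t M (length xs) ⟩
      M + t * suc (length xs)   ≤⟨ M≤ ⟩
      length R                  ≡⟨ ↭-length p ⟩
      length (a ++ R′)          ≡⟨ length-++ a ⟩
      length a + length R′      ≡⟨ cong (_+ length R′) len ⟩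
      t + length R′             ∎)
      where
      open ≤-Reasoning
      peel-one : ∀ t M n → t + (M + t * n) ≡ M + t * suc n
      peel-one = solve-∀

  -- As long as more than `M` elements lie outside `R`, the first of them has at least `M`
  -- companions there, and a block is found without touching `R`. At most `M` elements are left for
  -- `absorb`, so a reservoir of `M + t * M` elements suffices.
  reduce : ∀ fuel xs R → length xs ≤ fuel → Unique (xs ++ R) → Reservoir R → M + t * M ≤ length R →
           suc t ∣ length (xs ++ R) → Packable P (xs ++ R)
  reduce fuel xs R ≤fuel u res M≤ t∣ with length xs ≤? M
  ... | yes xs≤M = absorb xs R u res (≤-trans (+-monoʳ-≤ M (*-monoʳ-≤ t xs≤M)) M≤) t∣
  reduce fuel [] R ≤fuel u res M≤ t∣ | no xs≰M = contradiction z≤n xs≰M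
  reduce (suc fuel) (i ∷ xs) R (s≤s ≤fuel) u res M≤ t∣ | no xs≰M
    with extend-≤ {i} {xs} (Unique-resp-⊇ (refl ∷ Sub.++⁺ʳ R ⊆-refl) u) (≤-pred (≰⇒> xs≰M))
  ... | a , b , p , len , Pia = pack Pia
      (reduce fuel b R (≤-trans b≤xs ≤fuel)
              (Unique-resp-⊇ (Sub.++⁺ˡ (i ∷ a) ⊆-refl) (Unique-resp-↭ zs↭ u)) res M≤
              (∣-length-drop {i ∷ a} zs↭ (cong suc len) t∣))
      zs↭
    where
    zs↭ : i ∷ xs ++ R ↭ (i ∷ a) ++ b ++ R
    zs↭ = prep i (↭-trans (++⁺ʳ R p) (↭-reflexive (++-assoc a b R)))
    b≤xs : length b ≤ length xs
    b≤xs = ≤-trans (m≤n+m (length b) (length a))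
      (≤-reflexive (sym (trans (↭-length p) (length-++ a))))

  -- Ramsey's theorem yields a reservoir, since by extend no long list can
  -- avoid P on all its blocks.
  packable : Decidable P → ∀ xs → Unique xs → suc t ∣ length xs →
             ramseyNumber (suc t) (M + t * M) (suc M) ≤ length xs → Packable P xs
  packable P? xs u t∣ R≤ with ramsey (suc t) (M + t * M) (suc M) P? xs R≤
  ... | inj₁ (R , R⊆xs , len , hom) with ⊆-complement R⊆xs
  ...   | zs , p = Packable-resp-↭ (↭-sym p)
          (reduce (length zs) zs R ≤-refl (Unique-resp-↭ p u) (Homogeneous⇒Reservoir hom)
                  (≤-reflexive (sym len)) (subst (suc t ∣_) (↭-length p) t∣))
  packable P? xs u t∣ R≤ | inj₂ (i ∷ S , S⊆xs , len , avoid)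
    with extend {i} {S} (Unique-resp-⊇ S⊆xs u) (suc-injective len)
  ... | a , b , p , len-a , Pia with ⊆-resp-↭ʳ (Sub.++⁺ʳ b ⊆-refl) (↭-sym (prep i p))
  ...   | l , l⊆ , q = contradiction (P-resp-↭ q Pia)
          (avoid l⊆ (trans (sym (↭-length q)) (cong suc len-a)))

-- Finite sums of naturals

sum-mono-≤ : {f g : Fin n → ℕ} → (∀ i → f i ≤ g i) → sum f ≤ sum g
sum-mono-≤ {zero}  f≤g = z≤n
sum-mono-≤ {suc n} f≤g = +-mono-≤ (f≤g zero) (sum-mono-≤ (f≤g ∘ suc))

sum-const : ∀ n c → ∑[ i < n ] c ≡ n * c
sum-const zero    c = refl
sum-const (suc n) c = cong (c +_) (sum-const n c)

sum-zero : ∀ n → ∑[ i < n ] 0 ≡ 0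
sum-zero n = trans (sum-const n 0) (*-zeroʳ n)

term≤sum : (f : Fin n → ℕ) (i : Fin n) → f i ≤ sum f
term≤sum f zero    = m≤m+n _ _
term≤sum f (suc i) = ≤-trans (term≤sum (f ∘ suc) i) (m≤n+m _ _)

sum-positive : {f : Fin n → ℕ} → 0 < sum f → ∃[ i ] 0 < f i
sum-positive {suc n} {f} 0< with f zero in eq
... | suc _ = zero , subst (0 <_) (sym eq) z<s
... | zero with sum-positive {f = f ∘ suc} 0<
...   | i , 0<fi = suc i , 0<fi

𝟙 : Bool → ℕ
𝟙 true  = 1
𝟙 false = 0

erase : Fin n → (Fin n → Bool) → Fin n → Bool
erase u L v = if does (u ≟ v) then false else L v

erase-⊆ : ∀ (u : Fin n) L {v} → erase u L v ≡ true → L v ≡ true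
erase-⊆ u L {v} eq with does (u ≟ v)
... | false = eq

sum-erase : ∀ {L : Fin n → Bool} {u} (f : Fin n → ℕ) → L u ≡ true →
            ∑[ v < n ] (𝟙 (L v) * f v) ≡ f u + ∑[ v < n ] (𝟙 (erase u L v) * f v)
sum-erase {suc n} {L} {zero}  f Lu rewrite Lu = cong₂ _+_ (+-identityʳ (f zero)) refl
sum-erase {suc n} {L} {suc u} f Lu =
  trans (cong (𝟙 (L zero) * f zero +_) (sum-erase {L = L ∘ suc} (f ∘ suc) Lu))
        (exchange (𝟙 (L zero) * f zero) (f (suc u)) _)
  where
  exchange : ∀ a b c → a + (b + c) ≡ b + (a + c)
  exchange = solve-∀

sum-δ : ∀ (i : Fin n) (f : Fin n → ℕ) → ∑[ j < n ] (𝟙 (does (i ≟ j)) * f j) ≡ f i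
sum-δ {suc n} zero    f = trans (cong₂ _+_ (+-identityʳ (f zero)) (sum-zero n)) (+-identityʳ (f zero))
sum-δ {suc n} (suc i) f = sum-δ i (f ∘ suc)

sum-δ-injective : ∀ {m} {σ : Fin n → Fin m} → Injective _≡_ _≡_ σ → ∀ c p →
                  ∑[ i < n ] (𝟙 (does (σ i ≟ c)) * p) ≤ p
sum-δ-injective {n} {σ = σ} inj c p with any? (λ i → σ i ≟ c)
... | yes (i , σi≡c) = ≤-trans (sum-mono-≤ pointwise) (≤-reflexive (sum-δ i (λ _ → p)))
  where
  pointwise : ∀ j → 𝟙 (does (σ j ≟ c)) * p ≤ 𝟙 (does (i ≟ j)) * p
  pointwise j with σ j ≟ c
  ... | no _     = z≤n
  ... | yes σj≡c rewrite dec-true (i ≟ j) (inj (trans σi≡c (sym σj≡c))) = ≤-refl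
... | no σ≢c = ≤-trans (sum-mono-≤ {g = λ _ → 0} pointwise) (≤-trans (≤-reflexive (sum-zero n)) z≤n)
  where
  pointwise : ∀ j → 𝟙 (does (σ j ≟ c)) * p ≤ 0
  pointwise j rewrite dec-false (σ j ≟ c) (λ eq → σ≢c (j , eq)) = z≤n

-- Passing to a subgraph of large minimum degree

mass : (Fin n → ℕ) → (Fin n → Bool) → ℕ
mass {n} α L = ∑[ u < n ] (𝟙 (L u) * α u)

size : (Fin n → Bool) → ℕ
size = mass (λ _ → 1)

size-erase : ∀ L {u : Fin n} → L u ≡ true → size L ≡ suc (size (erase u L))
size-erase L = sum-erase {L = L} (λ _ → 1)

deg : (Fin n → Fin n → ℕ) → (Fin n → Bool) → Fin n → ℕ
deg K A u = mass (K u) A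

edges : (Fin n → Fin n → ℕ) → (L A : Fin n → Bool) → ℕ
edges K L A = mass (deg K A) L

edges-flip : ∀ (K : Fin n → Fin n → ℕ) L A → edges K L A ≡ edges (flip K) A L
edges-flip {n} K L A = begin
  ∑[ u < n ] (𝟙 (L u) * ∑[ v < n ] (𝟙 (A v) * K u v))
    ≡⟨ sum-cong-≗ (λ u → *-distribˡ-sum {n} (𝟙 (L u)) _) ⟩
  ∑[ u < n ] ∑[ v < n ] (𝟙 (L u) * (𝟙 (A v) * K u v))    ≡⟨ ∑-comm {n} {n} _ ⟩
  ∑[ v < n ] ∑[ u < n ] (𝟙 (L u) * (𝟙 (A v) * K u v))
    ≡⟨ sum-cong-≗ (λ v → sum-cong-≗ (λ u → exchange (𝟙 (L u)) (𝟙 (A v)) _)) ⟩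
  ∑[ v < n ] ∑[ u < n ] (𝟙 (A v) * (𝟙 (L u) * K u v))
    ≡⟨ sum-cong-≗ (λ v → *-distribˡ-sum {n} (𝟙 (A v)) _) ⟨
  ∑[ v < n ] (𝟙 (A v) * ∑[ u < n ] (𝟙 (L u) * K u v))    ∎
  where
  open ≡-Reasoning
  exchange : ∀ a b c → a * (b * c) ≡ b * (a * c)
  exchange = solve-∀

-- The two sides of the incidence are separate copies of the vertex set: a vertex may be deleted on
-- one side and stay on the other. The last field controls the weight of the edges lost.
record Pruned (K : Fin n → Fin n → ℕ) (α : Fin n → ℕ) (L A : Fin n → Bool) : Set where
  field
    left     : Fin n → Bool
    right    : Fin n → Bool
    left-⊆   : ∀ {u} → left u ≡ true → L u ≡ true
    left-deg  : ∀ {u} → left u ≡ true → α u < deg K right u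
    right-deg : ∀ {v} → right v ≡ true → α v < deg (flip K) left v
    bound    : edges K L A ≤ edges K left right + (mass α L + mass α A)

-- A vertex of degree at most α is deleted as long as there is one; its
-- deletion costs no more edges than the mass it takes away.
prune : ∀ (K : Fin n → Fin n → ℕ) α fuel L A → size L + size A ≤ fuel → Pruned K α L A
prune K α fuel L A ≤fuel with any? (λ u → (L u Bool.≟ true) ×-dec (deg K A u ≤? α u))
prune K α zero L A ≤fuel | yes (u , Lu , _) =
  contradiction (subst (_≤ 0) (cong (_+ size A) (size-erase L Lu)) ≤fuel) λ ()
prune K α (suc fuel) L A ≤fuel | yes (u , Lu , small) = record
  { Pruned rest; left-⊆ = erase-⊆ u L ∘ left-⊆
  ; bound = begin
      edges K L A                                           ≡⟨ sum-erase (deg K A) Lu ⟩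
      deg K A u + edges K (erase u L) A                     ≤⟨ +-mono-≤ small bound ⟩
      α u + (edges K left right + (mass α (erase u L) + mass α A))
        ≡⟨ regroup (α u) (edges K left right) (mass α (erase u L)) (mass α A) ⟩
      edges K left right + ((α u + mass α (erase u L)) + mass α A)
        ≡⟨ cong (λ z → edges K left right + (z + mass α A)) (sum-erase α Lu) ⟨
      edges K left right + (mass α L + mass α A)            ∎ }
  where
  open ≤-Reasoning
  rest : Pruned K α (erase u L) A
  rest = prune K α fuel (erase u L) A (≤-pred (subst (_≤ suc fuel) (cong (_+ size A) (size-erase L Lu)) ≤fuel))
  open Pruned rest
  regroup : ∀ a b c d → a + (b + (c + d)) ≡ b + ((a + c) + d)
  regroup = solve-∀
prune K α fuel L A ≤fuel | no ¬l with any? (λ v → (A v Bool.≟ true) ×-dec (deg (flip K) L v ≤? α v))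
prune K α zero L A ≤fuel | no ¬l | yes (v , Av , _) =
  contradiction (subst (_≤ 0) (trans (cong (size L +_) (size-erase A Av)) (+-suc (size L) _)) ≤fuel) λ ()
prune K α (suc fuel) L A ≤fuel | no ¬l | yes (v , Av , small) = record
  { Pruned rest
  ; bound = begin
      edges K L A                                           ≡⟨ edges-flip K L A ⟩
      edges (flip K) A L                                    ≡⟨ sum-erase (deg (flip K) L) Av ⟩
      deg (flip K) L v + edges (flip K) (erase v A) L
        ≡⟨ cong (deg (flip K) L v +_) (edges-flip K L (erase v A)) ⟨
      deg (flip K) L v + edges K L (erase v A)              ≤⟨ +-mono-≤ small bound ⟩
      α v + (edges K left right + (mass α L + mass α (erase v A)))
        ≡⟨ regroup (α v) (edges K left right) (mass α L) (mass α (erase v A)) ⟩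
      edges K left right + (mass α L + (α v + mass α (erase v A)))
        ≡⟨ cong (λ z → edges K left right + (mass α L + z)) (sum-erase α Av) ⟨
      edges K left right + (mass α L + mass α A)            ∎ }
  where
  open ≤-Reasoning
  rest : Pruned K α L (erase v A)
  rest = prune K α fuel L (erase v A)
    (≤-pred (subst (_≤ suc fuel) (trans (cong (size L +_) (size-erase A Av)) (+-suc (size L) _)) ≤fuel))
  open Pruned rest
  regroup : ∀ a b c d → a + (b + (c + d)) ≡ b + (c + (a + d))
  regroup = solve-∀
prune K α fuel L A ≤fuel | no ¬l | no ¬r = record
  { left = L ; right = A ; left-⊆ = λ Lu → Lu
  ; left-deg = λ Lu → ≰⇒> λ small → ¬l (_ , Lu , small)
  ; right-deg = λ Av → ≰⇒> λ small → ¬r (_ , Av , small)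
  ; bound = m≤m+n _ _ }

-- Weighted sums

module Integral (ω : Fin n → ℕ) where

  ∫ : (Fin n → ℕ) → ℕ
  ∫ f = ∑[ v < n ] (ω v * f v)

  ∬ : (Fin n → Fin n → ℕ) → ℕ
  ∬ F = ∑[ u < n ] ∑[ v < n ] (ω u * ω v * F u v)

  ∫-mono : ∀ {f g} → (∀ v → f v ≤ g v) → ∫ f ≤ ∫ g
  ∫-mono f≤g = sum-mono-≤ (λ v → *-monoʳ-≤ (ω v) (f≤g v))

  ∬-mono : ∀ {F G} → (∀ u v → F u v ≤ G u v) → ∬ F ≤ ∬ G
  ∬-mono F≤G = sum-mono-≤ (λ u → sum-mono-≤ (λ v → *-monoʳ-≤ (ω u * ω v) (F≤G u v)))

  ∫-cong : ∀ {f g} → (∀ v → f v ≡ g v) → ∫ f ≡ ∫ g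
  ∫-cong f≡g = sum-cong-≗ (λ v → cong (ω v *_) (f≡g v))

  ∫-+ : ∀ f g → ∫ (λ v → f v + g v) ≡ ∫ f + ∫ g
  ∫-+ f g = trans (sum-cong-≗ (λ v → *-distribˡ-+ (ω v) (f v) (g v))) (∑-distrib-+ {n} _ _)

  ∬-+ : ∀ F G → ∬ (λ u v → F u v + G u v) ≡ ∬ F + ∬ G
  ∬-+ F G = trans (sum-cong-≗ (λ u → trans
    (sum-cong-≗ (λ v → *-distribˡ-+ (ω u * ω v) (F u v) (G u v))) (∑-distrib-+ {n} _ _))) (∑-distrib-+ {n} _ _)

  ∬-flip : ∀ F → ∬ (flip F) ≡ ∬ F
  ∬-flip F = trans (∑-comm {n} {n} _)
    (sum-cong-≗ (λ u → sum-cong-≗ (λ v → cong (_* F u v) (*-comm (ω v) (ω u)))))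

  ∬-* : ∀ f g → ∬ (λ u v → f u * g v) ≡ ∫ f * ∫ g
  ∬-* f g = trans
    (sum-cong-≗ (λ u → trans (sum-cong-≗ (λ v → regroup (ω u) (ω v) (f u) (g v)))
                             (sym (*-distribˡ-sum {n} (ω u * f u) _))))
    (sym (*-distribʳ-sum {n} (∫ g) (λ u → ω u * f u)))
    where
    regroup : ∀ a b c d → a * b * (c * d) ≡ a * c * (b * d)
    regroup = solve-∀

  ∬≡∫∫ : ∀ F → ∬ F ≡ ∫ (λ u → ∫ (F u))
  ∬≡∫∫ F = sum-cong-≗ (λ u → trans (sum-cong-≗ (λ v → *-assoc (ω u) (ω v) (F u v)))
                                   (sym (*-distribˡ-sum {n} (ω u) _)))

  ∫-complement : ∀ X → ∫ (𝟙 ∘ X) + ∫ (𝟙 ∘ not ∘ X) ≡ sum ω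
  ∫-complement X = trans (sym (∫-+ _ _))
    (sum-cong-≗ (λ v → trans (cong (ω v *_) (excluded (X v))) (*-identityʳ (ω v))))
    where
    excluded : ∀ b → 𝟙 b + 𝟙 (not b) ≡ 1
    excluded true  = refl
    excluded false = refl

4ab≤[a+b]² : ∀ a b → 4 * (a * b) ≤ (a + b) * (a + b)
4ab≤[a+b]² a b with ≤-total a b
... | inj₁ a≤b with m≤n⇒∃[o]m+o≡n a≤b
...   | d , refl = subst (4 * (a * (a + d)) ≤_) (square a d) (m≤m+n _ (d * d))
  where
  square : ∀ a d → 4 * (a * (a + d)) + d * d ≡ (a + (a + d)) * (a + (a + d))
  square = solve-∀
4ab≤[a+b]² a b | inj₂ b≤a with m≤n⇒∃[o]m+o≡n b≤a
...   | d , refl = subst (4 * ((b + d) * b) ≤_) (square b d) (m≤m+n _ (d * d))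
  where
  square : ∀ b d → 4 * ((b + d) * b) + d * d ≡ ((b + d) + b) * ((b + d) + b)
  square = solve-∀

-- With y = q + s and x = y + r the two sides differ by s² + 2sr.
two-squares : ∀ {q y x} → q ≤ y → y ≤ x →
              2 * (y * y) + (x + q) * (x + q) ≤ (x + y) * (x + y) + 2 * (q * q)
two-squares {q} q≤y y≤x with m≤n⇒∃[o]m+o≡n q≤y
... | s , refl with m≤n⇒∃[o]m+o≡n y≤x
...   | r , refl = subst (2 * ((q + s) * (q + s)) + (q + s + r + q) * (q + s + r + q) ≤_)
                     (difference q s r) (m≤m+n _ (s * s + 2 * (s * r)))
  where
  difference : ∀ q s r →
    2 * ((q + s) * (q + s)) + (q + s + r + q) * (q + s + r + q) + (s * s + 2 * (s * r)) ≡
    (q + s + r + (q + s)) * (q + s + r + (q + s)) + 2 * (q * q)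
  difference = solve-∀

𝟙-∧ : ∀ a b → 𝟙 (a ∧ b) ≡ 𝟙 a * 𝟙 b
𝟙-∧ true  b = sym (+-identityʳ (𝟙 b))
𝟙-∧ false b = refl

𝟙≤1 : ∀ b → 𝟙 b ≤ 1
𝟙≤1 true  = ≤-refl
𝟙≤1 false = z≤n

∧-true : ∀ {a b} → a ∧ b ≡ true → a ≡ true × b ≡ true
∧-true {true} {true} _ = refl , refl

-- Paths between vertices of X

module Paths
  (ω : Fin n → ℕ)
  (adj : Fin n → Fin n → Bool) (adj-sym : ∀ u v → adj u v ≡ adj v u)
  {I : Set} (_≟ᴵ_ : DecidableEquality I) (label : Fin n → I)
  (adj⇒label≢ : ∀ {u v} → adj u v ≡ true → label u ≢ label v)
  where

  open Integral ω

  -- Values of `vertex` beyond `ℓ` are junk. Distinctness is asked of labels, that is, of parts, so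
  -- that the path is transversal. Paths grow at the head while the last vertex stays fixed; `H`
  -- tracks the set in which the head lies.
  record Path (H X : Fin n → Bool) (ℓ : ℕ) : Set where
    field
      vertex   : ℕ → Fin n
      joined   : ∀ {i} → i < ℓ → adj (vertex i) (vertex (suc i)) ≡ true
      distinct : ∀ {i j} → i < j → j ≤ ℓ → label (vertex i) ≢ label (vertex j)
      positive : ∀ {i} → i ≤ ℓ → 0 < ω (vertex i)
      head∈H   : H (vertex 0) ≡ true
      last∈X   : X (vertex ℓ) ≡ true

    labels : List I
    labels = applyUpTo (label ∘ vertex) (suc ℓ)

  prepend : ∀ {H H′ X ℓ} (p : Path H X ℓ) (let open Path p) {v} → adj v (vertex 0) ≡ true → 0 < ω v →
            H′ v ≡ true → label v ∉ labels → Path H′ X (suc ℓ)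
  prepend {H′ = H′} {X} {ℓ} p {v} v~ 0<ωv v∈H′ v∉ = record
    { vertex   = vertex′
    ; joined   = λ { {zero} _ → v~ ; {suc i} (s≤s i<ℓ) → joined i<ℓ }
    ; distinct = λ { {zero} {suc j} _ j<ℓ eq → v∉ (subst (_∈ˡ labels) (sym eq) (∈-applyUpTo⁺ (label ∘ vertex) j<ℓ))
                   ; {suc i} {suc j} (s≤s i<j) (s≤s j≤ℓ) → distinct i<j j≤ℓ }
    ; positive = λ { {zero} _ → 0<ωv ; {suc i} (s≤s i≤ℓ) → positive i≤ℓ }
    ; head∈H   = v∈H′
    ; last∈X   = last∈X
    }
    where
    open Path p
    vertex′ : ℕ → Fin n
    vertex′ zero    = v
    vertex′ (suc i) = vertex i

  trivialPath : ∀ {H X v} → H v ≡ true → X v ≡ true → 0 < ω v → Path H X 0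
  trivialPath {v = v} v∈H v∈X 0<ωv = record
    { vertex = λ _ → v ; joined = λ () ; distinct = λ { {j = suc _} _ () } ; positive = λ _ → 0<ωv
    ; head∈H = v∈H ; last∈X = v∈X }

  Path-⊆ : ∀ {H H′ X X′ ℓ} → (∀ {v} → H v ≡ true → H′ v ≡ true) → (∀ {v} → X v ≡ true → X′ v ≡ true) →
           Path H X ℓ → Path H′ X′ ℓ
  Path-⊆ H⊆ X⊆ p = record { Path p ; head∈H = H⊆ (Path.head∈H p) ; last∈X = X⊆ (Path.last∈X p) }

  module _ (P : ℕ) (label-weight : ∀ c → ∫ (λ v → 𝟙 (does (label v ≟ᴵ c))) ≤ P) where

    -- Discarding one label removes weight at most `P`, so `B` still has positive weight after all
    -- labels of `cs` are discarded.
    avoid : ∀ cs B → length cs * P < ∫ (𝟙 ∘ B) → ∃[ v ] B v ≡ true × 0 < ω v × label v ∉ cs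
    avoid [] B 0<∫ with sum-positive 0<∫
    ... | v , 0<ωB with B v in Bv
    ...   | true  = v , Bv , subst (0 <_) (*-identityʳ (ω v)) 0<ωB , λ ()
    ...   | false = contradiction (subst (0 <_) (*-zeroʳ (ω v)) 0<ωB) λ ()
    avoid (c ∷ cs) B lt with avoid cs B′ (+-cancelˡ-< P _ _ (<-≤-trans lt split))
      where
      B′ : Fin n → Bool
      B′ v = B v ∧ not (does (label v ≟ᴵ c))
      pointwise : ∀ b d → 𝟙 b ≤ 𝟙 d + 𝟙 (b ∧ not d)
      pointwise false d     = z≤n
      pointwise true  true  = s≤s z≤n
      pointwise true  false = s≤s z≤n
      open ≤-Reasoning
      split : ∫ (𝟙 ∘ B) ≤ P + ∫ (𝟙 ∘ B′)
      split = begin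
        ∫ (𝟙 ∘ B)                                                ≤⟨ ∫-mono (λ v → pointwise (B v) _) ⟩
        ∫ (λ v → 𝟙 (does (label v ≟ᴵ c)) + 𝟙 (B′ v))             ≡⟨ ∫-+ _ _ ⟩
        ∫ (λ v → 𝟙 (does (label v ≟ᴵ c))) + ∫ (𝟙 ∘ B′)           ≤⟨ +-monoˡ-≤ _ (label-weight c) ⟩
        P + ∫ (𝟙 ∘ B′)                                           ∎
    ... | v , B′v , 0<ωv , v∉ with label v ≟ᴵ c
    ...   | yes _ = contradiction (trans (sym B′v) (Bool.∧-zeroʳ (B v))) λ ()
    ...   | no ≢c = v , proj₁ (∧-true B′v) , 0<ωv , λ { (here eq) → ≢c eq ; (there v∈) → v∉ v∈ }

    module _ (X : Fin n → Bool) (k : ℕ) where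

      weight : Fin n → Fin n → ℕ
      weight u v = ω u * ω v * 𝟙 (adj u v)

      -- By `deg-weight` the factor `ω u` cancels: a degree above this means that the neighbours of
      -- `u` on the other side weigh more than `k * P`, so some neighbour avoids any `k` given
      -- labels.
      threshold : Fin n → ℕ
      threshold u = k * P * ω u

      deg-weight : ∀ A u → deg weight A u ≡ ω u * ∫ (λ v → 𝟙 (A v ∧ adj u v))
      deg-weight A u = trans (sum-cong-≗ (λ v → trans (regroup (𝟙 (A v)) (ω u) (ω v) _)
          (cong (λ z → ω u * (ω v * z)) (sym (𝟙-∧ (A v) (adj u v))))))
        (sym (*-distribˡ-sum {n} (ω u) _))
        where
        regroup : ∀ a x y b → a * (x * y * b) ≡ x * (y * (a * b))
        regroup = solve-∀

      weight-flip : ∀ u v → weight v u ≡ weight u v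
      weight-flip u v = cong₂ _*_ (*-comm (ω v) (ω u)) (cong 𝟙 (adj-sym v u))

      deg-flip : ∀ A u → deg (flip weight) A u ≡ deg weight A u
      deg-flip A u = sum-cong-≗ (λ v → cong (𝟙 (A v) *_) (weight-flip u v))

      module _ {A u} (large : threshold u < deg weight A u) where

        large⇒positive : 0 < ω u
        large⇒positive with ω u | subst (threshold u <_) (deg-weight A u) large
        ... | zero  | lt = contradiction lt λ ()
        ... | suc _ | _  = z<s

        neighbour : ∀ cs → length cs ≤ k → ∃[ v ] A v ≡ true × adj v u ≡ true × 0 < ω v × label v ∉ cs
        neighbour cs cs≤k with avoid cs (λ v → A v ∧ adj u v) (≤-<-trans (*-monoˡ-≤ P cs≤k)
          (*-cancelˡ-< (ω u) _ _ (subst₂ _<_ (*-comm (k * P) (ω u)) (deg-weight A u) large)))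
        ... | v , Av∧uv , 0<ωv , v∉ with ∧-true Av∧uv
        ...   | Av , uv = v , Av , trans (adj-sym v u) uv , 0<ωv , v∉

      module FromPruned (pruned : Pruned weight threshold X (λ _ → true)) where

        open Pruned pruned renaming (left to L; right to A)

        -- Opaque, since with-abstractions over these proofs would otherwise normalise them.
        abstract
          L-neighbour : ∀ {u} → A u ≡ true → ∀ cs → length cs ≤ k →
                        ∃[ v ] L v ≡ true × adj v u ≡ true × 0 < ω v × label v ∉ cs
          L-neighbour {u} Au = neighbour {L} {u} (subst (threshold u <_) (deg-flip L u) (right-deg Au))

          A-neighbour : ∀ {u} → L u ≡ true → ∀ cs → length cs ≤ k →
                        ∃[ v ] A v ≡ true × adj v u ≡ true × 0 < ω v × label v ∉ cs
          A-neighbour {u} Lu = neighbour {A} {u} (left-deg Lu)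

        A-positive : ∀ {u} → A u ≡ true → 0 < ω u
        A-positive {u} Au = large⇒positive {L} {u} (subst (threshold u <_) (deg-flip L u) (right-deg Au))

        extend-by : ∀ {H H′ ℓ} → (∀ {u} → H u ≡ true → ∀ cs → length cs ≤ k →
                      ∃[ v ] H′ v ≡ true × adj v u ≡ true × 0 < ω v × label v ∉ cs) →
                    suc ℓ ≤ k → Path H L ℓ → Path H′ L (suc ℓ)
        extend-by {ℓ = ℓ} next ℓ<k p
          with next (Path.head∈H p) (Path.labels p)
                    (subst (_≤ k) (sym (length-applyUpTo (label ∘ Path.vertex p) (suc ℓ))) ℓ<k)
        ... | v , v∈H′ , v~ , 0<ωv , v∉ = prepend p v~ 0<ωv v∈H′ v∉

        -- The path is y, u, v, x with x and y in `L`. The vertex x is chosen first and has to avoid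
        -- the label of u as well, since u is prepended later.
        edge⇒path₃ : ∀ {u v} → A u ≡ true → A v ≡ true → adj u v ≡ true → 3 ≤ k → Path L L 3
        edge⇒path₃ {u} {v} Au Av uv 3≤k
          with L-neighbour Av (label u ∷ label v ∷ []) (≤-trans (n≤1+n 2) 3≤k)
        ... | x , Lx , xv , 0<ωx , x∉ = extend-by L-neighbour 3≤k from-u
          where
          from-x : Path L L 0
          from-x = trivialPath Lx Lx 0<ωx
          v∉ : label v ∉ label x ∷ []
          v∉ (here eq) = x∉ (there (here (sym eq)))
          from-v : Path A L 1
          from-v = prepend from-x (trans (adj-sym v x) xv) (A-positive Av) Av v∉
          u∉ : label u ∉ label v ∷ label x ∷ []
          u∉ (here eq)         = adj⇒label≢ uv eq
          u∉ (there (here eq)) = x∉ (here (sym eq))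
          from-u : Path A L 2
          from-u = prepend from-v uv (A-positive Au) Au u∉

        -- An edge uv inside A is continued on both sides into L, and then
        -- alternates between A and L for as long as we like.
        edge⇒path : ∀ {u v} → A u ≡ true → A v ≡ true → adj u v ≡ true →
                    ∀ j → 3 + j * 2 ≤ k → Path L L (3 + j * 2)
        edge⇒path Au Av uv zero    3≤k = edge⇒path₃ Au Av uv 3≤k
        edge⇒path Au Av uv (suc j) ≤k = extend-by {A} {L} L-neighbour ≤k
          (extend-by {L} {A} A-neighbour (<⇒≤ ≤k) shorter)
          where
          shorter : Path L L (3 + j * 2)
          shorter = edge⇒path Au Av uv j (<⇒≤ (<⇒≤ ≤k))

        module _ (independent : ∀ u v → A u ≡ true → A v ≡ true → adj u v ≡ false) where

          W x y q : ℕ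
          W = sum ω
          x = ∫ (𝟙 ∘ X)
          y = ∫ (𝟙 ∘ not ∘ X)
          q = ∫ (λ v → 𝟙 (A v ∧ not (X v)))

          q≤y : q ≤ y
          q≤y = ∫-mono (λ v → pointwise (A v) (not (X v)))
            where
            pointwise : ∀ a b → 𝟙 (a ∧ b) ≤ 𝟙 b
            pointwise true  b = ≤-refl
            pointwise false b = z≤n

          -- A vertex of `L` has a neighbour in `A` because of its degree; were it in `A` too, that
          -- edge would lie within `A`.
          L∩A≡∅ : ∀ {v} → L v ≡ true → A v ≡ false
          L∩A≡∅ {v} Lv with A v in Av
          ... | false = refl
          ... | true with A-neighbour Lv [] z≤n
          ...   | u , Au , uv , _ = contradiction (trans (sym uv) (independent u v Au Av)) λ ()

          -- `L` and the part of `A` inside `X` are disjoint subsets of `X`; the rest of `A` weighs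
          -- `q`.
          ∫L+∫A≤x+q : ∫ (𝟙 ∘ L) + ∫ (𝟙 ∘ A) ≤ x + q
          ∫L+∫A≤x+q = subst₂ _≤_ (∫-+ _ _) (∫-+ _ _) (∫-mono pointwise)
            where
            pointwise : ∀ v → 𝟙 (L v) + 𝟙 (A v) ≤ 𝟙 (X v) + 𝟙 (A v ∧ not (X v))
            pointwise v with L v in Lv
            ... | true rewrite left-⊆ Lv | L∩A≡∅ Lv = ≤-refl
            ... | false with A v | X v
            ...   | true  | true  = ≤-refl
            ...   | true  | false = ≤-refl
            ...   | false | true  = z≤n
            ...   | false | false = z≤n

          ∬X : ℕ
          ∬X = ∬ (λ u v → 𝟙 (X u) * 𝟙 (adj u v))

          edges-weight : ∀ B C → edges weight B C ≡ ∬ (λ u v → 𝟙 (B u) * (𝟙 (C v) * 𝟙 (adj u v)))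
          edges-weight B C = sum-cong-≗ (λ u → trans (*-distribˡ-sum {n} (𝟙 (B u)) _)
            (sum-cong-≗ (λ v → regroup (𝟙 (B u)) (𝟙 (C v)) (ω u * ω v) _)))
            where
            regroup : ∀ b c w a → b * (c * (w * a)) ≡ w * (b * (c * a))
            regroup = solve-∀

          mass-threshold : ∀ B → mass threshold B ≤ k * P * W
          mass-threshold B = ≤-trans (sum-mono-≤ (λ u → *-monoˡ-≤ (threshold u) (𝟙≤1 (B u))))
            (≤-reflexive (trans (sum-cong-≗ (λ u → *-identityˡ (threshold u))) (sym (*-distribˡ-sum {n} (k * P) ω))))

          -- Pruning loses at most `k * P * W` on each side, and the edges that survive are bounded
          -- by the full product of `L` and `A`.
          ∬X≤ : ∬X ≤ ∫ (𝟙 ∘ L) * ∫ (𝟙 ∘ A) + 2 * (k * P * W)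
          ∬X≤ = begin
            ∬X
              ≡⟨ sum-cong-≗ (λ u → sum-cong-≗ (λ v → cong (λ z → ω u * ω v * (𝟙 (X u) * z)) (sym (+-identityʳ (𝟙 (adj u v)))))) ⟩
            ∬ (λ u v → 𝟙 (X u) * (1 * 𝟙 (adj u v)))        ≡⟨ edges-weight X (λ _ → true) ⟨
            edges weight X (λ _ → true)                    ≤⟨ bound ⟩
            edges weight L A + (mass threshold X + mass threshold (λ _ → true))
              ≤⟨ +-mono-≤ L×A (+-mono-≤ (mass-threshold X) (mass-threshold (λ _ → true))) ⟩
            ∫ (𝟙 ∘ L) * ∫ (𝟙 ∘ A) + (k * P * W + k * P * W)
              ≡⟨ cong (λ z → ∫ (𝟙 ∘ L) * ∫ (𝟙 ∘ A) + (k * P * W + z)) (+-identityʳ (k * P * W)) ⟨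
            ∫ (𝟙 ∘ L) * ∫ (𝟙 ∘ A) + 2 * (k * P * W)        ∎
            where
            open ≤-Reasoning
            L×A : edges weight L A ≤ ∫ (𝟙 ∘ L) * ∫ (𝟙 ∘ A)
            L×A = begin
              edges weight L A                                        ≡⟨ edges-weight L A ⟩
              ∬ (λ u v → 𝟙 (L u) * (𝟙 (A v) * 𝟙 (adj u v)))
                ≤⟨ ∬-mono (λ u v → *-monoʳ-≤ (𝟙 (L u)) (*-monoʳ-≤ (𝟙 (A v)) (𝟙≤1 (adj u v)))) ⟩
              ∬ (λ u v → 𝟙 (L u) * (𝟙 (A v) * 1))                     ≡⟨ ∬-* (𝟙 ∘ L) (λ v → 𝟙 (A v) * 1) ⟩
              ∫ (𝟙 ∘ L) * ∫ (λ v → 𝟙 (A v) * 1)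
                ≡⟨ cong (∫ (𝟙 ∘ L) *_) (∫-cong (λ v → *-identityʳ (𝟙 (A v)))) ⟩
              ∫ (𝟙 ∘ L) * ∫ (𝟙 ∘ A)                                   ∎

          -- An edge not meeting X joins two vertices outside X, not both in A.
          e+q²≤y²+2∬X : ∬ (λ u v → 𝟙 (adj u v)) + q * q ≤ y * y + 2 * ∬X
          e+q²≤y²+2∬X = begin
            ∬ (λ u v → 𝟙 (adj u v)) + q * q
              ≡⟨ cong (∬ (λ u v → 𝟙 (adj u v)) +_) (∬-* AY AY) ⟨
            ∬ (λ u v → 𝟙 (adj u v)) + ∬ (λ u v → AY u * AY v)
              ≡⟨ ∬-+ _ _ ⟨
            ∬ (λ u v → 𝟙 (adj u v) + AY u * AY v)
              ≤⟨ ∬-mono pointwise ⟩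
            ∬ (λ u v → Y u * Y v + (𝟙 (X u) * 𝟙 (adj u v) + 𝟙 (X v) * 𝟙 (adj v u)))
              ≡⟨ trans (∬-+ _ _) (cong₂ _+_ (∬-* Y Y) (trans (∬-+ _ _) (cong (∬X +_) (∬-flip _)))) ⟩
            y * y + (∬X + ∬X)
              ≡⟨ cong (λ z → y * y + (∬X + z)) (+-identityʳ ∬X) ⟨
            y * y + 2 * ∬X ∎
            where
            open ≤-Reasoning
            Y AY : Fin n → ℕ
            Y v  = 𝟙 (not (X v))
            AY v = 𝟙 (A v ∧ not (X v))
            bit : ∀ a b c d z → 𝟙 z + 𝟙 (a ∧ not c) * 𝟙 (b ∧ not d) ≤
                  𝟙 (not c) * 𝟙 (not d) + (𝟙 c * 𝟙 z + 𝟙 d * 𝟙 z) ⊎ (a ≡ true × b ≡ true × z ≡ true)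
            bit a b true d false rewrite Bool.∧-zeroʳ a = inj₁ z≤n
            bit a b true d true rewrite Bool.∧-zeroʳ a = inj₁ (s≤s z≤n)
            bit a b false true false rewrite Bool.∧-zeroʳ b | *-zeroʳ (𝟙 (a ∧ true)) = inj₁ z≤n
            bit a b false true true rewrite Bool.∧-zeroʳ b | *-zeroʳ (𝟙 (a ∧ true)) = inj₁ (s≤s z≤n)
            bit true  true  false false true  = inj₂ (refl , refl , refl)
            bit true  true  false false false = inj₁ (s≤s z≤n)
            bit true  false false false true  = inj₁ (s≤s z≤n)
            bit true  false false false false = inj₁ z≤n
            bit false b     false false true  = inj₁ (s≤s z≤n)
            bit false b     false false false = inj₁ z≤n
            pointwise : ∀ u v → 𝟙 (adj u v) + AY u * AY v ≤ Y u * Y v + (𝟙 (X u) * 𝟙 (adj u v) + 𝟙 (X v) * 𝟙 (adj v u))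
            pointwise u v rewrite adj-sym v u with bit (A u) (A v) (X u) (X v) (adj u v)
            ... | inj₁ le = le
            ... | inj₂ (Au , Av , uv) = contradiction (trans (sym uv) (independent u v Au Av)) λ ()

          -- Double `e+q²≤y²+2∬X` and insert `∬X≤`. By the inequality of arithmetic and geometric
          -- means, four times the product of the weights of `L` and `A` is at most
          -- `(x + q) * (x + q)`. Then `two-squares`, where `y ≤ x` enters, bounds the main terms by
          -- `(x + y) * (x + y)` plus `2 * (q * q)`, and the latter cancels.
          sparse : y ≤ x → 2 * ∬ (λ u v → 𝟙 (adj u v)) ≤ W * W + 8 * (k * P * W)
          sparse y≤x = +-cancelʳ-≤ (2 * (q * q)) _ _ (begin
            2 * e + 2 * (q * q)                               ≡⟨ *-distribˡ-+ 2 e (q * q) ⟨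
            2 * (e + q * q)                                   ≤⟨ *-monoʳ-≤ 2 e+q²≤y²+2∬X ⟩
            2 * (y * y + 2 * ∬X)
              ≤⟨ *-monoʳ-≤ 2 (+-monoʳ-≤ (y * y) (*-monoʳ-≤ 2 ∬X≤)) ⟩
            2 * (y * y + 2 * (ℓ * a + 2 * θ))                 ≡⟨ regroup (y * y) (ℓ * a) θ ⟩
            2 * (y * y) + 4 * (ℓ * a) + 8 * θ                 ≤⟨ +-monoˡ-≤ (8 * θ) (+-monoʳ-≤ (2 * (y * y))
                (≤-trans (4ab≤[a+b]² ℓ a) (*-mono-≤ ∫L+∫A≤x+q ∫L+∫A≤x+q))) ⟩
            2 * (y * y) + (x + q) * (x + q) + 8 * θ           ≤⟨ +-monoˡ-≤ (8 * θ) (two-squares q≤y y≤x) ⟩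
            (x + y) * (x + y) + 2 * (q * q) + 8 * θ
              ≡⟨ cong (λ z → z * z + 2 * (q * q) + 8 * θ) (∫-complement X) ⟩
            W * W + 2 * (q * q) + 8 * θ                       ≡⟨ swap-last (W * W) (2 * (q * q)) (8 * θ) ⟩
            W * W + 8 * θ + 2 * (q * q)                       ∎)
            where
            open ≤-Reasoning
            e ℓ a θ : ℕ
            e = ∬ (λ u v → 𝟙 (adj u v))
            ℓ = ∫ (𝟙 ∘ L)
            a = ∫ (𝟙 ∘ A)
            θ = k * P * W
            regroup : ∀ y² b c → 2 * (y² + 2 * (b + 2 * c)) ≡ 2 * y² + 4 * b + 8 * c
            regroup = solve-∀
            swap-last : ∀ a b c → a + b + c ≡ a + c + b
            swap-last = solve-∀

        path-between-pruned : ∫ (𝟙 ∘ not ∘ X) ≤ ∫ (𝟙 ∘ X) →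
                       sum ω * sum ω + 8 * (k * P * sum ω) < 2 * ∬ (λ u v → 𝟙 (adj u v)) →
                       ∀ j → 3 + j * 2 ≤ k → Path X X (3 + j * 2)
        path-between-pruned y≤x dense j ≤k
          with any? (λ u → any? (λ v → (A u Bool.≟ true) ×-dec (A v Bool.≟ true) ×-dec (adj u v Bool.≟ true)))
        ... | yes (u , v , Au , Av , uv) = Path-⊆ left-⊆ left-⊆ (edge⇒path Au Av uv j ≤k)
        ... | no ¬edge = contradiction (sparse independent y≤x) (<⇒≱ dense)
          where
          independent : ∀ u v → A u ≡ true → A v ≡ true → adj u v ≡ false
          independent u v Au Av with adj u v in uv
          ... | false = refl
          ... | true  = contradiction (u , v , Au , Av , uv) ¬edge

      path-between : ∫ (𝟙 ∘ not ∘ X) ≤ ∫ (𝟙 ∘ X) →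
                     sum ω * sum ω + 8 * (k * P * sum ω) < 2 * ∬ (λ u v → 𝟙 (adj u v)) →
                     ∀ j → 3 + j * 2 ≤ k → Path X X (3 + j * 2)
      -- Pruning starts with all vertices on the right, so that every edge meeting `X` belongs to
      -- the incidence.
      path-between = FromPruned.path-between-pruned (prune weight threshold _ X (λ _ → true) ≤-refl)

-- Balanced vertex weights in dense multipartite graphs

mass-∑ : ∀ {M} (w : Fin M → ℕ) (g : Fin M → Fin n → ℕ) L →
         mass (λ u → ∑[ κ < M ] (w κ * g κ u)) L ≡ ∑[ κ < M ] (w κ * mass (g κ) L)
mass-∑ {n} {M} w g L = begin
  ∑[ u < n ] (𝟙 (L u) * ∑[ κ < M ] (w κ * g κ u))      ≡⟨ sum-cong-≗ (λ u → *-distribˡ-sum {M} (𝟙 (L u)) _) ⟩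
  ∑[ u < n ] ∑[ κ < M ] (𝟙 (L u) * (w κ * g κ u))      ≡⟨ ∑-comm {n} {M} _ ⟩
  ∑[ κ < M ] ∑[ u < n ] (𝟙 (L u) * (w κ * g κ u))
    ≡⟨ sum-cong-≗ (λ κ → sum-cong-≗ (λ u → exchange (𝟙 (L u)) (w κ) (g κ u))) ⟩
  ∑[ κ < M ] ∑[ u < n ] (w κ * (𝟙 (L u) * g κ u))      ≡⟨ sum-cong-≗ (λ κ → *-distribˡ-sum {n} (w κ) _) ⟨
  ∑[ κ < M ] (w κ * mass (g κ) L)                      ∎
  where
  open ≡-Reasoning
  exchange : ∀ a b c → a * (b * c) ≡ b * (a * c)
  exchange = solve-∀

suc∣n! : ∀ {k n} → suc k ≤ n → suc k ∣ n !
suc∣n! {k} k<n = ∣-trans (m∣m*n (k !)) (m≤n⇒m!∣n! k<n)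

module Dense {m} (G : PartiteGraph m) where

  open PartiteGraph G

  inPart : Fin m → Fin order → Bool
  inPart i v = does (partOf v ≟ i)

  partSize : Fin m → ℕ
  partSize i = size (inPart i)

  adjacent : Fin order → Fin order → Bool
  adjacent u v = does (adj? u v)

  edgeCount : Fin m → Fin m → ℕ
  edgeCount i j = edges (λ u v → 𝟙 (adjacent u v)) (inPart i) (inPart j)

  adjacent-sym : ∀ u v → adjacent u v ≡ adjacent v u
  adjacent-sym u v = does-⇔ (mk⇔ symm symm) (adj? u v) (adj? v u)

  adjacent⇒Adj : ∀ {u v} → adjacent u v ≡ true → Adj u v
  adjacent⇒Adj {u} {v} eq with adj? u v
  ... | yes uv = uv

  size≤ : ∀ {n} (L : Fin n → Bool) → size L ≤ n
  size≤ {n} L = ≤-trans (sum-mono-≤ {g = λ _ → 1} (λ u → ≤-trans (≤-reflexive (*-identityʳ (𝟙 (L u)))) (𝟙≤1 (L u))))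
    (≤-reflexive (trans (sum-const n 1) (*-identityʳ n)))

  partSize>0 : ∀ i → 0 < partSize i
  partSize>0 i with nonempty i
  ... | v , v∈Vᵢ = ≤-trans (≤-reflexive (cong (λ b → 𝟙 b * 1) (sym (dec-true (partOf v ≟ i) v∈Vᵢ))))
                           (term≤sum (λ v → 𝟙 (inPart i v) * 1) v)

  -- The common multiple order ! of the part sizes keeps all weights integral.
  balance : ∀ i → ∃[ w ] w * partSize i ≡ order !
  balance i with partSize i | partSize>0 i | size≤ (inPart i)
  ... | suc s | _ | s<order with suc∣n! s<order
  ...   | divides w eq = w , sym eq

  P : ℕ
  P = order !

  wt : Fin m → ℕ
  wt i = proj₁ (balance i)

  wt*partSize : ∀ i → wt i * partSize i ≡ P
  wt*partSize i = proj₂ (balance i)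

  module Weights {M} (σ : Fin M → Fin m) (σ-injective : Injective _≡_ _≡_ σ) where

    -- Each selected part gets total weight `P`, and the vertices of all other parts get weight 0.
    -- Positive weight thus keeps the paths inside the selected parts.
    ω : Fin order → ℕ
    ω v = ∑[ κ < M ] (wt (σ κ) * 𝟙 (inPart (σ κ) v))

    open Integral ω public

    ∫-parts : ∀ f → ∫ f ≡ ∑[ κ < M ] (wt (σ κ) * mass f (inPart (σ κ)))
    ∫-parts f = begin
      ∑[ v < order ] (ω v * f v)
        ≡⟨ sum-cong-≗ (λ v → *-comm (ω v) (f v)) ⟩
      ∑[ v < order ] (f v * ω v)
        ≡⟨ sum-cong-≗ (λ v → *-distribˡ-sum {M} (f v) _) ⟩
      ∑[ v < order ] ∑[ κ < M ] (f v * (wt (σ κ) * 𝟙 (inPart (σ κ) v)))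
                                                                      ≡⟨ ∑-comm {order} {M} _ ⟩
      ∑[ κ < M ] ∑[ v < order ] (f v * (wt (σ κ) * 𝟙 (inPart (σ κ) v)))
        ≡⟨ sum-cong-≗ (λ κ → sum-cong-≗ (λ v → rotate (f v) (wt (σ κ)) _)) ⟩
      ∑[ κ < M ] ∑[ v < order ] (wt (σ κ) * (𝟙 (inPart (σ κ) v) * f v))
        ≡⟨ sum-cong-≗ (λ κ → *-distribˡ-sum {order} (wt (σ κ)) _) ⟨
      ∑[ κ < M ] (wt (σ κ) * mass f (inPart (σ κ)))                   ∎
      where
      open ≡-Reasoning
      rotate : ∀ a b c → a * (b * c) ≡ b * (c * a)
      rotate = solve-∀

    total : sum ω ≡ M * P
    total = begin
      sum ω                                            ≡⟨ sum-cong-≗ (λ v → *-identityʳ (ω v)) ⟨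
      ∫ (λ _ → 1)                                      ≡⟨ ∫-parts (λ _ → 1) ⟩
      ∑[ κ < M ] (wt (σ κ) * partSize (σ κ))           ≡⟨ sum-cong-≗ (λ κ → wt*partSize (σ κ)) ⟩
      ∑[ κ < M ] P                                     ≡⟨ sum-const M P ⟩
      M * P                                            ∎
      where open ≡-Reasoning

    part-weight : ∀ c → ∫ (λ v → 𝟙 (inPart c v)) ≤ P
    part-weight c = begin
      ∫ (λ v → 𝟙 (inPart c v))                                           ≡⟨ ∫-parts _ ⟩
      ∑[ κ < M ] (wt (σ κ) * mass (𝟙 ∘ inPart c) (inPart (σ κ)))         ≤⟨ sum-mono-≤ pointwise ⟩
      ∑[ κ < M ] (𝟙 (does (σ κ ≟ c)) * P)                                ≤⟨ sum-δ-injective σ-injective c P ⟩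
      P                                                                  ∎
      where
      open ≤-Reasoning
      disjoint : ∀ {i} → i ≢ c → ∀ v → 𝟙 (inPart i v) * 𝟙 (inPart c v) ≡ 0
      disjoint {i} i≢c v with partOf v ≟ i
      ... | no _ = refl
      ... | yes refl rewrite dec-false (partOf v ≟ c) i≢c = refl
      pointwise : ∀ κ → wt (σ κ) * mass (𝟙 ∘ inPart c) (inPart (σ κ)) ≤ 𝟙 (does (σ κ ≟ c)) * P
      pointwise κ with σ κ ≟ c
      ... | yes refl = begin
        wt (σ κ) * mass (𝟙 ∘ inPart c) (inPart (σ κ))
          ≤⟨ *-monoʳ-≤ (wt (σ κ)) (sum-mono-≤ (λ v → *-monoʳ-≤ (𝟙 (inPart (σ κ) v)) (𝟙≤1 (inPart c v)))) ⟩
        wt (σ κ) * partSize (σ κ)                       ≡⟨ wt*partSize (σ κ) ⟩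
        P                                               ≡⟨ +-identityʳ P ⟨
        P + 0                                           ∎
      ... | no σκ≢c = ≤-reflexive (trans (cong (wt (σ κ) *_)
        (trans (sum-cong-≗ (disjoint σκ≢c)) (sum-zero order))) (*-zeroʳ (wt (σ κ))))

    positive⇒selected : ∀ {v} → 0 < ω v → ∃[ κ ] partOf v ≡ σ κ
    positive⇒selected {v} 0<ωv with sum-positive 0<ωv
    ... | κ , 0<κ with partOf v ≟ σ κ
    ...   | yes eq = κ , eq
    ...   | no _   = contradiction (subst (0 <_) (*-zeroʳ (wt (σ κ))) 0<κ) λ ()

    mass-∫ : ∀ F L → mass (λ u → ∫ (F u)) L ≡ ∑[ κ < M ] (wt (σ κ) * edges F L (inPart (σ κ)))
    mass-∫ F L = trans (sum-cong-≗ (λ u → cong (𝟙 (L u) *_) (∫-parts (F u)))) (mass-∑ (wt ∘ σ) _ L)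

    ∬-parts : ∀ F → ∬ F ≡ ∑[ κ < M ] ∑[ μ < M ] (wt (σ κ) * (wt (σ μ) * edges F (inPart (σ κ)) (inPart (σ μ))))
    ∬-parts F = trans (∬≡∫∫ F) (trans (∫-parts _) (sum-cong-≗ (λ κ →
      trans (cong (wt (σ κ) *_) (mass-∫ F (inPart (σ κ)))) (*-distribˡ-sum {M} (wt (σ κ)) _))))

    edgeWeight : ℕ
    edgeWeight = ∬ (λ u v → 𝟙 (adjacent u v))

    -- The hypothesis is density at least (D + 1) / (2D) = 1/2 + 1/(2D), cleared of denominators.
    module _ {D} (dense : ∀ {i j} → i ≢ j → suc D * (partSize i * partSize j) ≤ 2 * D * edgeCount i j) where

      weighted-dense : ∀ {i j} → i ≢ j → suc D * (P * P) ≤ 2 * D * (wt i * (wt j * edgeCount i j))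
      weighted-dense {i} {j} i≢j = begin
        suc D * (P * P)
          ≡⟨ cong₂ (λ p q → suc D * (p * q)) (wt*partSize i) (wt*partSize j) ⟨
        suc D * (wt i * partSize i * (wt j * partSize j))
          ≡⟨ regroup₁ (suc D) (wt i) (partSize i) (wt j) (partSize j) ⟩
        wt i * wt j * (suc D * (partSize i * partSize j))
          ≤⟨ *-monoʳ-≤ (wt i * wt j) (dense i≢j) ⟩
        wt i * wt j * (2 * D * edgeCount i j)
          ≡⟨ regroup₂ (wt i) (wt j) (2 * D) (edgeCount i j) ⟩
        2 * D * (wt i * (wt j * edgeCount i j))                        ∎
        where
        open ≤-Reasoning
        regroup₁ : ∀ d w a x b → d * (w * a * (x * b)) ≡ w * x * (d * (a * b))
        regroup₁ = solve-∀
        regroup₂ : ∀ w x d e → w * x * (d * e) ≡ d * (w * (x * e))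
        regroup₂ = solve-∀

      -- `weighted-dense` is summed over all ordered pairs of selected parts. Pairs on the diagonal
      -- carry no edges; the last summand pays for them.
      edgeWeight-≥ : M * (M * (suc D * (P * P))) ≤ 2 * D * edgeWeight + M * (suc D * (P * P))
      edgeWeight-≥ = begin
        M * (M * C)                                                      ≡⟨ sum-const M (M * C) ⟨
        ∑[ κ < M ] (M * C)
          ≡⟨ sum-cong-≗ {M} (λ κ → sum-const M C) ⟨
        ∑[ κ < M ] ∑[ μ < M ] C
          ≤⟨ sum-mono-≤ {M} (λ κ → sum-mono-≤ {M} (pointwise κ)) ⟩
        ∑[ κ < M ] ∑[ μ < M ] (2 * D * E κ μ + 𝟙 (does (κ ≟ μ)) * C)
          ≡⟨ sum-cong-≗ (λ κ → ∑-distrib-+ {M} (λ μ → 2 * D * E κ μ) (λ μ → 𝟙 (does (κ ≟ μ)) * C)) ⟩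
        ∑[ κ < M ] (∑[ μ < M ] (2 * D * E κ μ) + ∑[ μ < M ] (𝟙 (does (κ ≟ μ)) * C))
                                                                         ≡⟨ ∑-distrib-+ {M} _ _ ⟩
        ∑[ κ < M ] ∑[ μ < M ] (2 * D * E κ μ) + ∑[ κ < M ] ∑[ μ < M ] (𝟙 (does (κ ≟ μ)) * C)
                                                                         ≡⟨ cong₂ _+_ first second ⟩
        2 * D * edgeWeight + M * C                                       ∎
        where
        open ≤-Reasoning
        C : ℕ
        C = suc D * (P * P)
        E : Fin M → Fin M → ℕ
        E κ μ = wt (σ κ) * (wt (σ μ) * edgeCount (σ κ) (σ μ))
        pointwise : ∀ κ μ → C ≤ 2 * D * E κ μ + 𝟙 (does (κ ≟ μ)) * C
        pointwise κ μ with κ ≟ μ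
        ... | yes _  = ≤-trans (≤-reflexive (sym (+-identityʳ C))) (m≤n+m (C + 0) (2 * D * E κ μ))
        ... | no κ≢μ = ≤-trans (weighted-dense (κ≢μ ∘ σ-injective)) (m≤m+n _ 0)
        first : ∑[ κ < M ] ∑[ μ < M ] (2 * D * E κ μ) ≡ 2 * D * edgeWeight
        first = trans (sum-cong-≗ (λ κ → sym (*-distribˡ-sum {M} (2 * D) (E κ))))
          (trans (sym (*-distribˡ-sum {M} (2 * D) (λ κ → sum (E κ))))
                 (cong (2 * D *_) (sym (∬-parts _))))
        second : ∑[ κ < M ] ∑[ μ < M ] (𝟙 (does (κ ≟ μ)) * C) ≡ M * C
        second = trans (sum-cong-≗ {M} (λ κ → sum-δ κ (λ _ → C))) (sum-const M C)

      P*P>0 : 0 < P * P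
      P*P>0 = *-mono-≤ (n!>0 order) (n!>0 order)
        where
        n!>0 : ∀ n → 0 < n !
        n!>0 = λ n → 1≤n! n

      -- The value of M is chosen so that D(M + 8k) < (M - 1)(D + 1).
      edgeWeight-large : ∀ k → M ≡ suc (suc (D + 8 * k * D)) →
                         sum ω * sum ω + 8 * (k * P * sum ω) < 2 * edgeWeight
      edgeWeight-large k refl = *-cancelˡ-< D _ _ (+-cancelʳ-< (M * C) _ _ (begin-strict
        D * (sum ω * sum ω + 8 * (k * P * sum ω)) + M * C
          ≡⟨ cong (λ w → D * (w * w + 8 * (k * P * w)) + M * C) total ⟩
        D * (M * P * (M * P) + 8 * (k * P * (M * P))) + M * C
          <⟨ m<m+n _ (*-mono-≤ {1} {M} (s≤s z≤n) P*P>0) ⟩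
        D * (M * P * (M * P) + 8 * (k * P * (M * P))) + M * C + M * (P * P)
                                                                   ≡⟨ arithmetic D k P ⟩
        M * (M * C)                                                ≤⟨ edgeWeight-≥ ⟩
        2 * D * edgeWeight + M * C                                 ≡⟨ cong (_+ M * C) (regroup D edgeWeight) ⟩
        D * (2 * edgeWeight) + M * C                               ∎))
        where
        open ≤-Reasoning
        C : ℕ
        C = suc D * (P * P)
        regroup : ∀ d e → 2 * d * e ≡ d * (2 * e)
        regroup = solve-∀
        arithmetic : ∀ D k P → let M = 2 + (D + 8 * k * D) in
          D * (M * P * (M * P) + 8 * (k * P * (M * P))) + M * ((1 + D) * (P * P)) + M * (P * P) ≡
          M * (M * ((1 + D) * (P * P)))
        arithmetic = solve-∀

      -- By averaging: if every vertex of part `i` saw less than half of the total weight, the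
      -- weighted number of edges from that part to the selected ones would be at most half of the
      -- maximum, against a density of at least 1/2 + 1/(2D).
      half-neighbourhood : ∀ {i} → (∀ κ → i ≢ σ κ) → 0 < M →
        ∃[ v ] partOf v ≡ i × ∫ (𝟙 ∘ not ∘ adjacent v) ≤ ∫ (𝟙 ∘ adjacent v)
      half-neighbourhood {i} i∉σ 0<M
        with any? (λ v → (partOf v ≟ i) ×-dec (∫ (𝟙 ∘ not ∘ adjacent v) ≤? ∫ (𝟙 ∘ adjacent v)))
      ... | yes found = found
      ... | no ¬found = contradiction (begin-strict
          D * (P * (M * P))                                           <⟨ m<m+n _ (*-mono-≤ 0<M P*P>0) ⟩
          D * (P * (M * P)) + M * (P * P)                             ≡⟨ regroup₁ D P M ⟩
          M * (suc D * (P * P))                                       ≡⟨ sum-const M _ ⟨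
          ∑[ κ < M ] (suc D * (P * P))
            ≤⟨ sum-mono-≤ (λ κ → weighted-dense (i∉σ κ)) ⟩
          ∑[ κ < M ] (2 * D * (wt i * (wt (σ κ) * edgeCount i (σ κ))))
                                                                      ≡⟨ *-distribˡ-sum {M} (2 * D) _ ⟨
          2 * D * ∑[ κ < M ] (wt i * (wt (σ κ) * edgeCount i (σ κ)))
            ≡⟨ cong (2 * D *_) (*-distribˡ-sum {M} (wt i) _) ⟨
          2 * D * (wt i * ∑[ κ < M ] (wt (σ κ) * edgeCount i (σ κ)))
            ≡⟨ cong (λ z → 2 * D * (wt i * z)) (mass-∫ _ (inPart i)) ⟨
          2 * D * (wt i * mass degree (inPart i))
            ≡⟨ regroup₂ D (wt i) (mass degree (inPart i)) ⟩
          D * (wt i * (2 * mass degree (inPart i)))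
            ≡⟨ cong (λ z → D * (wt i * z)) (*-distribˡ-sum {order} 2 _) ⟩
          D * (wt i * ∑[ v < order ] (2 * (𝟙 (inPart i v) * degree v)))
            ≤⟨ *-monoʳ-≤ D (*-monoʳ-≤ (wt i) (sum-mono-≤ small)) ⟩
          D * (wt i * ∑[ v < order ] (𝟙 (inPart i v) * 1 * (M * P)))
            ≡⟨ cong (λ z → D * (wt i * z)) (*-distribʳ-sum {order} (M * P) _) ⟨
          D * (wt i * (partSize i * (M * P)))
            ≡⟨ cong (D *_) (*-assoc (wt i) (partSize i) (M * P)) ⟨
          D * (wt i * partSize i * (M * P))
            ≡⟨ cong (λ z → D * (z * (M * P))) (wt*partSize i) ⟩
          D * (P * (M * P))                                           ∎) (<-irrefl refl)
        where
        open ≤-Reasoning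
        degree : Fin order → ℕ
        degree v = ∫ (𝟙 ∘ adjacent v)
        regroup₁ : ∀ d p m → d * (p * (m * p)) + m * (p * p) ≡ m * ((1 + d) * (p * p))
        regroup₁ = solve-∀
        regroup₂ : ∀ d w z → 2 * d * (w * z) ≡ d * (w * (2 * z))
        regroup₂ = solve-∀
        small : ∀ v → 2 * (𝟙 (inPart i v) * degree v) ≤ 𝟙 (inPart i v) * 1 * (M * P)
        small v with partOf v ≟ i
        ... | no _ = z≤n
        ... | yes v∈Vᵢ = begin
          2 * (1 * degree v)                          ≡⟨ double (degree v) ⟩
          degree v + degree v
            ≤⟨ +-monoʳ-≤ (degree v) (<⇒≤ (≰⇒> λ le → ¬found (v , v∈Vᵢ , le))) ⟩
          degree v + ∫ (𝟙 ∘ not ∘ adjacent v)         ≡⟨ ∫-complement (adjacent v) ⟩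
          sum ω                                       ≡⟨ total ⟩
          M * P                                       ≡⟨ *-identityˡ (M * P) ⟨
          1 * (M * P)                                 ∎
          where
          double : ∀ z → 2 * (1 * z) ≡ z + z
          double = solve-∀

-- Exhaustive search and maps between finite sets

any-vec? : ∀ {n k} {Q : Vec (Fin n) k → Set} → (∀ c → Dec (Q c)) → Dec (∃ Q)
any-vec? {k = zero}  Q? = map′ ([] ,_) (λ { ([] , q) → q }) (Q? [])
any-vec? {k = suc k} Q? = map′ (λ (x , c , q) → x ∷ c , q) (λ { (x ∷ c , q) → x , c , q })
  (any? (λ x → any-vec? (λ c → Q? (x ∷ c))))

Unique-lookup-injective : ∀ {A : Set} {xs : List A} → Unique xs → Injective _≡_ _≡_ (lookup xs)
Unique-lookup-injective {xs = _ ∷ xs} (_ ∷ _)  {zero}  {zero}  _  = refl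
Unique-lookup-injective {xs = _ ∷ xs} (x∉ ∷ _) {zero}  {suc j} eq = contradiction eq (All.lookup x∉ (∈-lookup j))
Unique-lookup-injective {xs = _ ∷ xs} (x∉ ∷ _) {suc i} {zero}  eq = contradiction (sym eq) (All.lookup x∉ (∈-lookup i))
Unique-lookup-injective {xs = _ ∷ xs} (_ ∷ u)  {suc i} {suc j} eq = cong suc (Unique-lookup-injective u eq)

split-off : ∀ {A : Set} {xs ys : List A} → Unique xs → (∀ {x} → x ∈ˡ xs → x ∈ˡ ys) → ∃[ zs ] ys ↭ xs ++ zs
split-off {ys = ys} [] xs⊆ys = ys , ↭-refl
split-off {xs = x ∷ xs} (x∉ ∷ u) xs⊆ys with ∈-∃++ (xs⊆ys (here refl))
... | as , bs , refl with split-off {ys = as ++ bs} u remaining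
  where
  remaining : ∀ {z} → z ∈ˡ xs → z ∈ˡ as ++ bs
  remaining z∈ with ∈-++⁻ as (xs⊆ys (there z∈))
  ... | inj₁ z∈as             = ∈-++⁺ˡ z∈as
  ... | inj₂ (here refl)      = contradiction refl (All.lookup x∉ z∈)
  ... | inj₂ (there z∈bs)     = ∈-++⁺ʳ as z∈bs
...   | zs , p = zs , ↭-trans (shift x as bs) (prep x p)

-- If a value were missed, punching it out would give an injection of `Fin (suc n)` into `Fin n`.
injective⇒surjective : ∀ {n} {f : Fin n → Fin n} → Injective _≡_ _≡_ f → ∀ y → ∃[ x ] f x ≡ y
injective⇒surjective {suc n} {f} inj y with any? (λ x → f x ≟ y)
... | yes found = found
... | no missed = contradiction
  (injective⇒≤ {f = λ x → punchOut (λ eq → missed (x , sym eq))} (inj ∘ punchOut-injective {i = y} _ _)) 1+n≰n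

-- The right inverse provided by `surj` is injective, hence onto, so `f` is its two-sided inverse.
surjective⇒injective : ∀ {n} {f : Fin n → Fin n} → (∀ y → ∃[ x ] f x ≡ y) → Injective _≡_ _≡_ f
surjective⇒injective {f = f} surj {x} {x′} eq
  with injective⇒surjective g-injective x | injective⇒surjective g-injective x′
  where
  g-injective : Injective _≡_ _≡_ (proj₁ ∘ surj)
  g-injective {y} {y′} eq = trans (sym (proj₂ (surj y))) (trans (cong f eq) (proj₂ (surj y′)))
... | y , refl | y′ , refl = cong (proj₁ ∘ surj) (trans (sym (proj₂ (surj y))) (trans eq (proj₂ (surj y′))))

-- Cycles covering given parts, and traversals

module Cycles {m} (G : PartiteGraph m) (t : ℕ) where

  open PartiteGraph G

  IsCycle : Vec (Fin order) t → Set
  IsCycle c = ∀ x y → Next x y → Adj (Vec.lookup c x) (Vec.lookup c y)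

  Covers : Vec (Fin order) t → List (Fin m) → Set
  Covers c = All (λ i → ∃[ x ] partOf (Vec.lookup c x) ≡ i)

  -- The corners are not asked to be distinct. This is recovered by counting in
  -- `packable⇒traversal`, where all the corners together meet as many parts as there are corners.
  Spanned : List (Fin m) → Set
  Spanned l = length l ≡ t × ∃[ c ] IsCycle c × Covers c l

  -- The colouring handed to Ramsey's theorem must be decidable; here this is a search through all
  -- tuples of vertices.
  spanned? : ∀ l → Dec (Spanned l)
  spanned? l = (length l ℕ.≟ t) ×-dec any-vec? (λ c →
    (all? (λ x → all? (λ y → next? x y →-dec adj? (Vec.lookup c x) (Vec.lookup c y)))) ×-dec
    All.all? (λ i → any? (λ x → partOf (Vec.lookup c x) ≟ i)) l)

  Spanned-resp-↭ : ∀ {l l′} → l ↭ l′ → Spanned l → Spanned l′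
  Spanned-resp-↭ p (len , c , cyc , cov) = trans (sym (↭-length p)) len , c , cyc , All-resp-↭ p cov

  collect : ∀ r {zs} .{{_ : NonZero t}} → Packable Spanned zs → length zs ≡ r * t →
    Σ[ F ∈ (Fin r → Vec (Fin order) t) ]
      (∀ c → IsCycle (F c)) ×
      (∀ {i} → i ∈ˡ zs → ∃₂ λ c x → partOf (Vec.lookup (F c) x) ≡ i)
  collect zero    none _   = (λ ()) , (λ ()) , λ ()
  collect (suc r) none len = contradiction (sym len) (m<n⇒n≢0 (≤-trans (ℕ.>-nonZero⁻¹ t) (m≤m+n t _)))
  collect zero (pack {l} {xs} (len-l , _) rest p) len = contradiction
    (m+n≡0⇒m≡0 (length l) (trans (sym (length-++ l)) (trans (sym (↭-length p)) len)))
    (λ l≡0 → ℕ.≢-nonZero⁻¹ t (trans (sym len-l) l≡0))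
  collect (suc r) (pack {l} {xs} (len-l , c₀ , cyc₀ , cov₀) rest p) len
    with collect r rest (+-cancelˡ-≡ t _ _ (trans (cong (_+ length xs) (sym len-l))
                          (trans (sym (length-++ l)) (trans (sym (↭-length p)) len))))
  ... | F , cyc , cov = F′ , (λ { zero → cyc₀ ; (suc c) → cyc c }) , cov′
    where
    F′ : Fin (suc r) → Vec (Fin order) t
    F′ zero    = c₀
    F′ (suc c) = F c
    cov′ : ∀ {i} → i ∈ˡ _ → ∃₂ λ c x → partOf (Vec.lookup (F′ c) x) ≡ i
    cov′ i∈ with ∈-++⁻ l (∈-resp-↭ p i∈)
    ... | inj₁ i∈l  = zero , All.lookup cov₀ i∈l
    ... | inj₂ i∈xs with cov i∈xs
    ...   | c , x , eq = suc c , x , eq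

-- The `r * t` corners of the cycles meet all `r * t` parts, hence each part exactly once. This
-- gives both the traversal and the injectivity of the embedding.
packable⇒traversal : ∀ {r t} (3≤t : 3 ≤ t) (G : PartiteGraph (r * t)) →
  Packable (Cycles.Spanned G t) (allFin (r * t)) → HasTraversal (copies r (cycle t 3≤t)) G
packable⇒traversal {r} {t} 3≤t G packed
  with Cycles.collect G t r {{ℕ.>-nonZero (≤-trans z<s 3≤t)}} packed (length-tabulate _)
... | F , cyc , cov = T , traversal , f , f-injective , f∈ , f-edge
  where
  open PartiteGraph G
  corner : Fin r → Fin t → Fin order
  corner c = Vec.lookup (F c)

  f : Fin (r * t) → Fin order
  f u = corner (proj₁ (remQuot t u)) (proj₂ (remQuot {r} t u))

  onto : ∀ i → ∃[ u ] partOf (f u) ≡ i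
  onto i with cov (∈-allFin i)
  ... | c , x , eq = combine c x ,
    trans (cong (λ (c , x) → partOf (corner c x)) (remQuot-combine {r} {t} c x)) eq

  part-injective : Injective _≡_ _≡_ (partOf ∘ f)
  part-injective = surjective⇒injective onto

  f-injective : Injective _≡_ _≡_ f
  f-injective = part-injective ∘ cong partOf

  image? : ∀ v → Dec (∃[ u ] f u ≡ v)
  image? v = any? (λ u → f u ≟ v)

  image : Subset order
  image = tabulate (does ∘ image?)

  ∈-image⁺ : ∀ {v} → ∃[ u ] f u ≡ v → v ∈ image
  ∈-image⁺ {v} e = lookup⇒[]= v image (trans (lookup∘tabulate _ v) (dec-true (image? v) e))

  ∈-image⁻ : ∀ {v} → v ∈ image → ∃[ u ] f u ≡ v
  ∈-image⁻ {v} v∈ with image? v | trans (sym (lookup∘tabulate (does ∘ image?) v)) ([]=⇒lookup v∈)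
  ... | yes e | _ = e

  f∈ : ∀ u → f u ∈ image
  f∈ u = ∈-image⁺ (u , refl)

  T : Subgraph graph
  T = record
    { vertices = image
    ; edges = record
      { Adj    = λ u v → Adj u v × u ∈ image × v ∈ image
      ; adj?   = λ u v → adj? u v ×-dec (u ∈? image) ×-dec (v ∈? image)
      ; symm   = λ (uv , u∈ , v∈) → symm uv , v∈ , u∈
      ; irrefl = λ eq (uv , _) → irrefl eq uv
      }
    ; within   = proj₂
    ; included = proj₁
    }

  traversal : IsTraversal G T
  traversal i with onto i
  ... | u , fu∈Vᵢ = f u , (f∈ u , fu∈Vᵢ) , λ (v∈ , v∈Vᵢ) → unique v∈ v∈Vᵢ
    where
    unique : ∀ {v} → v ∈ image → partOf v ≡ i → f u ≡ v
    unique v∈ v∈Vᵢ with ∈-image⁻ v∈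
    ... | u′ , refl = cong f (part-injective (trans fu∈Vᵢ (sym v∈Vᵢ)))

  f-edge : ∀ {u v} → Graph.Adj (copies r (cycle t 3≤t)) u v → Adj (f u) (f v) × f u ∈ image × f v ∈ image
  f-edge {u} {v} (same , next) = along {proj₁ (remQuot t u)} {proj₁ (remQuot t v)} same next , f∈ u , f∈ v
    where
    along : ∀ {c c′ x y} → c ≡ c′ → Next x y ⊎ Next y x → Adj (corner c x) (corner c′ y)
    along {c} {x = x} {y} refl (inj₁ xy) = cyc c x y xy
    along {c} {x = x} {y} refl (inj₂ yx) = symm (cyc c y x yx)

-- Cycles in dense graphs and the packing of all parts

partsNeeded : ℕ → ℕ → ℕ
-- The value of `M` in `edgeWeight-large` for k = 3 + 2j, the length of the path that is to be
-- closed up.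
partsNeeded j D = 2 + (D + 8 * (3 + j * 2) * D)

-- With t = 5 + 2j and M = `partsNeeded j D`, the alternatives are a reservoir of M + (t - 1)M
-- parts, as `Packing.reduce` wants it, and M + 1 parts without a spanned block, which
-- `spanned-extension` rules out.
order-bound : ℕ → ℕ → ℕ
order-bound j D = ramseyNumber (5 + j * 2) (partsNeeded j D + (4 + j * 2) * partsNeeded j D) (suc (partsNeeded j D))

module _ {m} (G : PartiteGraph m) (j : ℕ) where

  open PartiteGraph G
  open Dense G
  open Cycles G (5 + j * 2)

  -- Some `v` in part `i` sees half of the weight of `S`. A path on 4 + 2j vertices in the parts of
  -- `S` with both ends adjacent to `v` is closed by `v` to a cycle of length 5 + 2j.
  spanned-extension : ∀ {D} → (∀ {i j} → i ≢ j → suc D * (partSize i * partSize j) ≤ 2 * D * edgeCount i j) →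
    ∀ {i S} → Unique (i ∷ S) → length S ≡ partsNeeded j D →
    ∃₂ λ a b → S ↭ a ++ b × length a ≡ 4 + j * 2 × Spanned (i ∷ a)
  spanned-extension {D} dense {i} {S} (i∉S ∷ S-unique) len =
    from-half (half-neighbourhood {D} dense i∉σ (subst (0 <_) (sym len) z<s))
    where
    σ : Fin (length S) → Fin m
    σ = lookup S
    i∉σ : ∀ κ → i ≢ σ κ
    i∉σ κ = All.lookup i∉S (∈-lookup κ)
    open Weights σ (Unique-lookup-injective S-unique)
    open Paths ω adjacent adjacent-sym _≟_ partOf (λ {u} {v} eq → independent (adjacent⇒Adj {u} {v} eq))

    from-path : ∀ {v} → partOf v ≡ i → Path (adjacent v) (adjacent v) (3 + j * 2) →
                ∃₂ λ a b → S ↭ a ++ b × length a ≡ 4 + j * 2 × Spanned (i ∷ a)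
    from-path {v} v∈Vᵢ p with split-off a-unique a⊆S
      where
      open Path p
      a-unique : Unique labels
      a-unique = Unique.applyUpTo⁺₁ (partOf ∘ vertex) (4 + j * 2) (λ k<l l< → distinct k<l (≤-pred l<))
      a⊆S : ∀ {z} → z ∈ˡ labels → z ∈ˡ S
      a⊆S z∈ with ∈-applyUpTo⁻ (partOf ∘ vertex) z∈
      ... | k , k< , refl with positive⇒selected (positive (≤-pred k<))
      ...   | κ , eq = subst (_∈ˡ S) (sym eq) (∈-lookup κ)
    ... | b , S↭ = labels , b , S↭ , length-applyUpTo (partOf ∘ vertex) (4 + j * 2) ,
                   cong suc (length-applyUpTo (partOf ∘ vertex) (4 + j * 2)) ,
                   tabulate (corner ∘ toℕ) , cyclic , covers
      where
      open Path p
      corner : ℕ → Fin order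
      corner zero    = v
      corner (suc k) = vertex k
      at : ∀ x → Vec.lookup (tabulate (corner ∘ toℕ)) x ≡ corner (toℕ {5 + j * 2} x)
      at = lookup∘tabulate (corner ∘ toℕ)
      step : ∀ k → suc k < 5 + j * 2 → Adj (corner k) (corner (suc k))
      step zero    _       = adjacent⇒Adj {v} head∈H
      step (suc k) (s≤s (s≤s k<)) = adjacent⇒Adj {vertex k} (joined k<)
      cyclic : IsCycle (tabulate (corner ∘ toℕ))
      cyclic x y (inj₁ y≡1+x) rewrite at x | at y | y≡1+x = step (toℕ x) (subst (_< 5 + j * 2) y≡1+x (toℕ<n y))
      -- The wrap-around edge goes from the last vertex of the path back to `v`.
      cyclic x y (inj₂ (1+x≡t , y≡0)) rewrite at x | at y | y≡0 | suc-injective 1+x≡t =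
        symm (adjacent⇒Adj {v} last∈X)
      covers : Covers (tabulate (corner ∘ toℕ)) (i ∷ labels)
      covers = (zero , v∈Vᵢ) ∷ All.applyUpTo⁺₁ (partOf ∘ vertex) (4 + j * 2) (λ {k} k< →
        suc (fromℕ< k<) , cong partOf (trans (at (suc (fromℕ< k<))) (cong vertex (toℕ-fromℕ< k<))))

    from-half : ∃[ v ] partOf v ≡ i × ∫ (𝟙 ∘ not ∘ adjacent v) ≤ ∫ (𝟙 ∘ adjacent v) →
                ∃₂ λ a b → S ↭ a ++ b × length a ≡ 4 + j * 2 × Spanned (i ∷ a)
    from-half (v , v∈Vᵢ , half) = from-path v∈Vᵢ
      -- Each new vertex of a path of length 3 + 2j has at most that many labels to avoid, so k = 3
      -- + 2j is enough.
      (path-between P part-weight (adjacent v) (3 + j * 2) half (edgeWeight-large {D} dense (3 + j * 2) len) j ≤-refl)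

  dense⇒packable : ∀ {D} → (∀ {i j} → i ≢ j → suc D * (partSize i * partSize j) ≤ 2 * D * edgeCount i j) →
    5 + j * 2 ∣ m → order-bound j D ≤ m → Packable Spanned (allFin m)
  dense⇒packable {D} dense t∣m large = Packing.packable {M = partsNeeded j D} Spanned-resp-↭ (spanned-extension {D} dense)
    spanned? (allFin m) (Unique.allFin⁺ m) (subst (5 + j * 2 ∣_) (sym (length-tabulate _)) t∣m)
    (subst (order-bound j D ≤_) (sym (length-tabulate _)) large)

-- Counting

length-filter-tabulate : ∀ {A : Set} {Q : Pred A 0ℓ} (Q? : Decidable Q) {n} (f : Fin n → A) →
                         length (filter Q? (List.tabulate f)) ≡ ∑[ i < n ] 𝟙 (does (Q? (f i)))
length-filter-tabulate Q? {zero}  f = refl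
length-filter-tabulate Q? {suc n} f with does (Q? (f zero))
... | true  = cong suc (length-filter-tabulate Q? (f ∘ suc))
... | false = length-filter-tabulate Q? (f ∘ suc)

length-filter-product : ∀ {A : Set} {k} {Q : Pred (A × Fin k) 0ℓ} (Q? : Decidable Q) {n} (f : Fin n → A) →
  length (filter Q? (cartesianProduct (List.tabulate f) (allFin k))) ≡
  ∑[ u < n ] ∑[ v < k ] 𝟙 (does (Q? (f u , v)))
length-filter-product {k = k} Q? {zero}  f = refl
length-filter-product {k = k} Q? {suc n} f = trans
  (trans (cong length (filter-++ Q? row rows)) (length-++ (filter Q? row)))
  (cong₂ _+_ (trans (cong (length ∘ filter Q?) (map-tabulate id (f zero ,_))) (length-filter-tabulate Q? (f zero ,_)))
             (length-filter-product Q? (f ∘ suc)))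
  where
  row  = map (f zero ,_) (allFin k)
  rows = cartesianProduct (List.tabulate (f ∘ suc)) (allFin k)

∣tabulate∣≡size : ∀ {n} (b : Fin n → Bool) → ∣ tabulate b ∣ ≡ size b
∣tabulate∣≡size {zero}  b = refl
∣tabulate∣≡size {suc n} b with b zero
... | true  = cong suc (∣tabulate∣≡size (b ∘ suc))
... | false = ∣tabulate∣≡size (b ∘ suc)

∈?-tabulate : ∀ {n} (b : Fin n → Bool) v → does (v ∈? tabulate b) ≡ b v
∈?-tabulate b zero with b zero
... | true  = refl
... | false = refl
∈?-tabulate b (suc v) = ∈?-tabulate (b ∘ suc) v

-- Fractions

/-≤⇒ : ∀ {a b c d} .{{_ : NonZero b}} .{{_ : NonZero d}} → (ℤ.+ a ℚ./ b) ℚ.≤ (ℤ.+ c ℚ./ d) → a * d ≤ c * b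
/-≤⇒ {a} {suc b} {c} {suc d} p≤q with ℚᵘ.≤-respʳ-≃ (ℚ.toℚᵘ-fromℚᵘ (mkℚᵘ (ℤ.+ c) d))
                                      (ℚᵘ.≤-respˡ-≃ (ℚ.toℚᵘ-fromℚᵘ (mkℚᵘ (ℤ.+ a) b)) (ℚ.toℚᵘ-mono-≤ p≤q))
... | *≤* le = ℤ.drop‿+≤+ (subst₂ ℤ._≤_ (sym (ℤ.pos-* a (suc d))) (sym (ℤ.pos-* c (suc b))) le)

/-≤⇐ : ∀ {a b c d} .{{_ : NonZero b}} .{{_ : NonZero d}} → a * d ≤ c * b → (ℤ.+ a ℚ./ b) ℚ.≤ (ℤ.+ c ℚ./ d)
/-≤⇐ {a} {suc b} {c} {suc d} le = ℚ.toℚᵘ-cancel-≤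
  (ℚᵘ.≤-respʳ-≃ (ℚᵘ.≃-sym (ℚ.toℚᵘ-fromℚᵘ (mkℚᵘ (ℤ.+ c) d)))
  (ℚᵘ.≤-respˡ-≃ (ℚᵘ.≃-sym (ℚ.toℚᵘ-fromℚᵘ (mkℚᵘ (ℤ.+ a) b)))
  (*≤* (subst₂ ℤ._≤_ (ℤ.pos-* a (suc d)) (ℤ.pos-* c (suc b)) (ℤ.+≤+ le)))))

-- With D the denominator of ε this is ½ + 1/(2D).
threshold-above-½ : ∀ D .{{_ : NonZero D}} → ℚ
threshold-above-½ D = (ℤ.+ suc D ℚ./ (2 * D)) {{m*n≢0 2 D}}

-- A positive ε with denominator D is at least 1/D, which exceeds 1/(2D).
threshold<½+ε : ∀ {ε} → 0ℚ ℚ.< ε → threshold-above-½ (ℚ.↧ₙ ε) ℚ.< ½ ℚ.+ ε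
threshold<½+ε {mkℚ (-[1+ n ]) d _} (ℚ.*<* ())
threshold<½+ε {mkℚ (ℤ.+ zero) d _} (ℚ.*<* (ℤ.+<+ ()))
threshold<½+ε {ε@(mkℚ (+[1+ n ]) d _)} _ = ℚ.toℚᵘ-cancel-<
  (ℚᵘ.<-respˡ-≃ (ℚᵘ.≃-sym (ℚ.toℚᵘ-fromℚᵘ (mkℚᵘ (ℤ.+ suc (suc d)) _)))
  (ℚᵘ.<-respʳ-≃ (ℚᵘ.≃-sym (ℚ.toℚᵘ-homo-+ ½ ε))
  -- Unnormalised, both sides have denominator 2(d + 1), so only the numerators are compared.
  (*<* (ℤ.*-monoʳ-<-pos (ℤ.+ (2 * suc d)) (ℤ.+<+ bound)))))
  where
  bound : suc (suc d) < 1 * suc d + suc n * 2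
  bound = begin-strict
    suc (suc d)              ≡⟨ +-comm 1 (suc d) ⟩
    suc d + 1                <⟨ +-monoʳ-< (suc d) (s≤s (s≤s z≤n)) ⟩
    suc d + suc n * 2        ≡⟨ cong (_+ suc n * 2) (*-identityˡ (suc d)) ⟨
    1 * suc d + suc n * 2    ∎
    where open ≤-Reasoning

½-ε<½ : ∀ {ε} → 0ℚ ℚ.< ε → ½ ℚ.- ε ℚ.< ½
½-ε<½ {ε} 0<ε = subst (½ ℚ.- ε ℚ.<_) (ℚ.+-identityʳ ½) (ℚ.+-monoʳ-< ½ (ℚ.neg-antimono-< 0<ε))

≢⇒<⊎> : ∀ {m} {i j : Fin m} → i ≢ j → toℕ i < toℕ j ⊎ toℕ j < toℕ i
≢⇒<⊎> {i = i} {j} i≢j with <-cmp i j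
... | tri< i<j _ _ = inj₁ i<j
... | tri≈ _ i≡j _ = contradiction i≡j i≢j
... | tri> _ _ j<i = inj₂ j<i

-- Densities expressed by edge counts

module _ {m} (G : PartiteGraph m) where

  open PartiteGraph G
  open Dense G

  ∣part∣≡partSize : ∀ i → ∣ part i ∣ ≡ partSize i
  ∣part∣≡partSize i = ∣tabulate∣≡size (inPart i)

  edgesBetween≡edgeCount : ∀ i j → edgesBetween graph (part i) (part j) ≡ edgeCount i j
  edgesBetween≡edgeCount i j = trans (length-filter-product between? id) (sum-cong-≗ (λ u →
    trans (sum-cong-≗ (λ v → trans (cong₂ (λ a b → 𝟙 (a ∧ (b ∧ adjacent u v)))
                                          (∈?-tabulate (inPart i) u) (∈?-tabulate (inPart j) v))
                                   (trans (𝟙-∧ (inPart i u) _) (cong (𝟙 (inPart i u) *_) (𝟙-∧ (inPart j v) _)))))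
          (sym (*-distribˡ-sum {order} (𝟙 (inPart i u)) _))))
    where
    between? : Decidable λ ((u , v) : Fin order × Fin order) → u ∈ part i × v ∈ part j × Adj u v
    between? (u , v) = (u ∈? part i) ×-dec (v ∈? part j) ×-dec adj? u v

  densityOf : Fin m × Fin m → ℚ
  densityOf (i , j) = density graph (part i) (part j) (part-nonempty i) (part-nonempty j)

  partiteDensity≤ : ∀ {i j} → toℕ i < toℕ j → partiteDensity G ℚ.≤ densityOf (i , j)
  partiteDensity≤ {i} {j} i<j = All.lookup (min≤xs 1ℚ (map densityOf (indexPairs m)))
    (∈-map⁺ densityOf (∈-filter⁺ _ (∈-cartesianProduct⁺ (∈-allFin i) (∈-allFin j)) i<j))

  sizes≢0 : ∀ i j → NonZero (∣ part i ∣ * ∣ part j ∣)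
  sizes≢0 i j = m*n≢0 ∣ part i ∣ ∣ part j ∣ {{nonempty⇒size≢0 (part-nonempty i)}} {{nonempty⇒size≢0 (part-nonempty j)}}

  sizes≡ : ∀ i j → ∣ part i ∣ * ∣ part j ∣ ≡ partSize i * partSize j
  sizes≡ i j = cong₂ _*_ (∣part∣≡partSize i) (∣part∣≡partSize j)

  density-≥⇒ : ∀ i j {a b} .{{_ : NonZero b}} → (ℤ.+ a ℚ./ b) ℚ.≤ densityOf (i , j) →
               a * (partSize i * partSize j) ≤ b * edgeCount i j
  density-≥⇒ i j {a} {b} {{b≢0}} le = subst₂ (λ s e → a * s ≤ b * e) (sizes≡ i j) (edgesBetween≡edgeCount i j)
    (≤-trans (/-≤⇒ {a} {b} {edgesBetween graph (part i) (part j)} {{b≢0}} {{sizes≢0 i j}} le)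
             (≤-reflexive (*-comm (edgesBetween graph (part i) (part j)) b)))

  density-≥⇐ : ∀ i j {a b} .{{_ : NonZero b}} → a * (partSize i * partSize j) ≤ b * edgeCount i j →
               (ℤ.+ a ℚ./ b) ℚ.≤ densityOf (i , j)
  density-≥⇐ i j {a} {b} {{b≢0}} le = /-≤⇐ {a} {b} {edgesBetween graph (part i) (part j)} {{b≢0}} {{sizes≢0 i j}}
    (≤-trans (subst₂ (λ s e → a * s ≤ b * e) (sym (sizes≡ i j)) (sym (edgesBetween≡edgeCount i j)) le)
             (≤-reflexive (*-comm b (edgesBetween graph (part i) (part j)))))

  edgeCount-sym : ∀ i j → edgeCount i j ≡ edgeCount j i
  edgeCount-sym i j = trans (edges-flip _ (inPart i) (inPart j))
    (sum-cong-≗ (λ u → cong (𝟙 (inPart j u) *_) (sum-cong-≗ (λ v → cong (λ b → 𝟙 (inPart i v) * 𝟙 b) (adjacent-sym v u)))))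

  threshold⇒dense-< : ∀ D .{{_ : NonZero D}} → threshold-above-½ D ℚ.≤ partiteDensity G →
                      ∀ {i j} → toℕ i < toℕ j → suc D * (partSize i * partSize j) ≤ 2 * D * edgeCount i j
  threshold⇒dense-< D u≤ {i} {j} i<j =
    density-≥⇒ i j {suc D} {2 * D} {{m*n≢0 2 D}} (ℚ.≤-trans u≤ (partiteDensity≤ i<j))

  -- The minimum in `partiteDensity` runs over i < j only; the other order follows by symmetry of
  -- the edge counts.
  threshold⇒dense : ∀ D .{{_ : NonZero D}} → threshold-above-½ D ℚ.≤ partiteDensity G →
                    ∀ {i j} → i ≢ j → suc D * (partSize i * partSize j) ≤ 2 * D * edgeCount i j
  threshold⇒dense D u≤ {i} {j} i≢j = [ threshold⇒dense-< D u≤ , flipped ]′ (≢⇒<⊎> i≢j)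
    where
    flipped : toℕ j < toℕ i → suc D * (partSize i * partSize j) ≤ 2 * D * edgeCount i j
    flipped j<i = subst₂ (λ s e → suc D * s ≤ 2 * D * e) (*-comm (partSize j) (partSize i)) (edgeCount-sym j i)
      (threshold⇒dense-< D u≤ j<i)

upper-bound : ∀ r j D .{{_ : NonZero D}} (3≤t : 3 ≤ 5 + j * 2) → order-bound j D ≤ r →
  (G : PartiteGraph (r * (5 + j * 2))) → threshold-above-½ D ℚ.≤ partiteDensity G →
  HasTraversal (copies r (cycle (5 + j * 2) 3≤t)) G
upper-bound r j D 3≤t large G u≤ = packable⇒traversal {r} 3≤t G
  (dense⇒packable G j {D} (threshold⇒dense G D u≤) (divides r refl) (≤-trans large (m≤m*n r (5 + j * 2))))

-- The bipartite extremal graph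

module Bipartite (m : ℕ) where

  partOf : Fin (m + m) → Fin m
  partOf = [ id , id ]′ ∘ splitAt m

  isLeft : ∀ {A B : Set} → A ⊎ B → Bool
  isLeft = [ (λ _ → true) , (λ _ → false) ]′

  side : Fin (m + m) → Bool
  side = isLeft ∘ splitAt m

  partOf-↑ˡ : ∀ i → partOf (i ↑ˡ m) ≡ i
  partOf-↑ˡ i = cong [ id , id ]′ (splitAt-↑ˡ m i m)

  partOf-↑ʳ : ∀ i → partOf (m ↑ʳ i) ≡ i
  partOf-↑ʳ i = cong [ id , id ]′ (splitAt-↑ʳ m m i)

  -- Each part has one vertex on either side, so two of the four pairs between two parts are edges
  -- and the density is 1/2. The sides are a proper 2-colouring, which excludes odd cycles.
  bipartite : PartiteGraph m
  bipartite = record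
    { order = m + m
    ; graph = record
      { Adj    = λ u v → partOf u ≢ partOf v × side u ≢ side v
      ; adj?   = λ u v → ¬? (partOf u ≟ partOf v) ×-dec ¬? (side u Bool.≟ side v)
      ; symm   = λ (p , s) → ≢-sym p , ≢-sym s
      ; irrefl = λ { refl (p , _) → p refl }
      }
    ; partOf = partOf
    ; nonempty = λ i → i ↑ˡ m , partOf-↑ˡ i
    ; independent = proj₁
    }

  open Dense bipartite hiding (P)
  open PartiteGraph bipartite using (Adj; adj?)

  sum-splitAt : ∀ a {b} (f : Fin (a + b) → ℕ) → sum f ≡ ∑[ i < a ] f (i ↑ˡ b) + ∑[ i < b ] f (a ↑ʳ i)
  sum-splitAt zero    f = refl
  sum-splitAt (suc a) f = trans (cong (f zero +_) (sum-splitAt a (f ∘ suc))) (sym (+-assoc (f zero) _ _))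

  partSize≤2 : ∀ i → partSize i ≤ 2
  partSize≤2 i = begin
    partSize i                                                        ≡⟨ sum-splitAt m _ ⟩
    ∑[ k < m ] (𝟙 (inPart i (k ↑ˡ m)) * 1) + ∑[ k < m ] (𝟙 (inPart i (m ↑ʳ k)) * 1)
      ≡⟨ cong₂ _+_ (sum-cong-≗ (λ k → cong (λ z → 𝟙 (does (z ≟ i)) * 1) (partOf-↑ˡ k)))
                   (sum-cong-≗ (λ k → cong (λ z → 𝟙 (does (z ≟ i)) * 1) (partOf-↑ʳ k))) ⟩
    ∑[ k < m ] (𝟙 (does (k ≟ i)) * 1) + ∑[ k < m ] (𝟙 (does (k ≟ i)) * 1)
      ≤⟨ +-mono-≤ (sum-δ-injective id i 1) (sum-δ-injective id i 1) ⟩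
    2 ∎
    where open ≤-Reasoning

  edge≤ : ∀ {i j u v} → partOf u ≡ i → partOf v ≡ j → i ≢ j → side u ≢ side v →
          1 ≤ 𝟙 (inPart i u) * deg (λ u v → 𝟙 (adjacent u v)) (inPart j) u
  edge≤ {i} {j} {u} {v} refl refl i≢j s≢ rewrite dec-true (partOf u ≟ i) refl = ≤-trans (begin
    1
      ≡⟨ cong₂ (λ a b → 𝟙 a * 𝟙 b) (dec-true (partOf v ≟ j) refl) (dec-true (adj? u v) (i≢j , s≢)) ⟨
    𝟙 (inPart j v) * 𝟙 (adjacent u v)            ≤⟨ term≤sum _ v ⟩
    deg (λ u v → 𝟙 (adjacent u v)) (inPart j) u  ∎) (m≤m+n _ 0)
    where open ≤-Reasoning

  edgeCount≥2 : ∀ {i j} → i ≢ j → 2 ≤ edgeCount i j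
  edgeCount≥2 {i} {j} i≢j = ≤-trans
    -- The two edges start at the left and at the right vertex of part `i`.
    (+-mono-≤ (≤-trans (edge≤ (partOf-↑ˡ i) (partOf-↑ʳ j) i≢j sides) (term≤sum {m} _ i))
              (≤-trans (edge≤ (partOf-↑ʳ i) (partOf-↑ˡ j) i≢j (≢-sym sides)) (term≤sum {m} _ i)))
    (≤-reflexive (sym (sum-splitAt m _)))
    where
    sides : ∀ {i j} → side (i ↑ˡ m) ≢ side (m ↑ʳ j)
    sides {i} {j} eq with trans (sym (cong isLeft (splitAt-↑ˡ m i m))) (trans eq (cong isLeft (splitAt-↑ʳ m m j)))
    ... | ()

  ½≤partiteDensity : ½ ℚ.≤ partiteDensity bipartite
  -- The first argument takes care of the default value 1 of `min`.
  ½≤partiteDensity = v≤min⁺ (toWitness {a? = ½ ℚ.≤? 1ℚ} tt) (All.map⁺ (All.tabulate ½≤))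
    where
    ½≤ : ∀ {p} → p ∈ˡ indexPairs m → ½ ℚ.≤ densityOf bipartite p
    ½≤ {i , j} p∈ = density-≥⇐ bipartite i j {1} {2} (begin
      1 * (partSize i * partSize j)    ≤⟨ *-monoʳ-≤ 1 (*-mono-≤ (partSize≤2 i) (partSize≤2 j)) ⟩
      2 * 2
        ≤⟨ *-monoʳ-≤ 2 (edgeCount≥2 λ { refl → <-irrefl refl i<j }) ⟩
      2 * edgeCount i j                ∎)
      where
      open ≤-Reasoning
      i<j : toℕ i < toℕ j
      i<j = proj₂ (∈-filter⁻ (λ p → proj₁ p Fin.<? proj₂ p) {xs = cartesianProduct (allFin m) (allFin m)} p∈)

-- Odd cycles have no proper 2-colouring

≢-≢⇒≡ : ∀ {a b c : Bool} → a ≢ b → b ≢ c → a ≡ c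
≢-≢⇒≡ a≢b b≢c = trans (Bool.¬-not a≢b) (trans (cong not (Bool.¬-not b≢c)) (Bool.not-involutive _))

-- Positions two apart have the same colour. Hence position 0 and the last position 2h agree,
-- although they are adjacent on the cycle.
odd-cycle-not-2-colourable : ∀ {h} {c : Fin (suc (h * 2)) → Bool} → ¬ (∀ x y → Next x y → c x ≢ c y)
odd-cycle-not-2-colourable {h} {c} proper = proper (fromℕ< last<) zero
  (inj₂ (cong suc (toℕ-fromℕ< last<) , refl)) (even h last<)
  where
  last< : h * 2 < suc (h * 2)
  last< = n<1+n _
  step : ∀ {k} (k< : k < suc (h * 2)) (1+k< : suc k < suc (h * 2)) → c (fromℕ< k<) ≢ c (fromℕ< 1+k<)
  step k< 1+k< = proper _ _ (inj₁ (trans (toℕ-fromℕ< 1+k<) (cong suc (sym (toℕ-fromℕ< k<)))))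
  even : ∀ k (k< : k * 2 < suc (h * 2)) → c (fromℕ< k<) ≡ c zero
  even zero    _  = refl
  even (suc k) k< = trans (sym (≢-≢⇒≡ (step k₀< k₁<) (step k₁< k<))) (even k k₀<)
    where
    k₁< : suc (k * 2) < suc (h * 2)
    k₁< = <-trans (n<1+n _) k<
    k₀< : k * 2 < suc (h * 2)
    k₀< = <-trans (n<1+n _) k₁<

-- The first copy alone gives an odd cycle in a 2-coloured graph; writing the number of copies as
-- `suc r` makes sure that there is one.
bipartite-no-traversal : ∀ r h (3≤t : 3 ≤ suc (h * 2)) →
  ¬ HasTraversal (copies (suc r) (cycle (suc (h * 2)) 3≤t)) (Bipartite.bipartite (suc r * suc (h * 2)))
bipartite-no-traversal r h 3≤t (T , _ , f , _ , _ , f-edge) =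
  odd-cycle-not-2-colourable {h} {c = colour} λ x y xy → proj₂ (Subgraph.included T (f-edge (joined x y xy)))
  where
  t m : ℕ
  t = suc (h * 2)
  m = suc r * t
  first : Fin t → Fin m
  first = combine {suc r} zero
  colour : Fin t → Bool
  colour x = Bipartite.side m (f (first x))
  joined : ∀ x y → Next x y → Graph.Adj (copies (suc r) (cycle t 3≤t)) (first x) (first y)
  joined x y xy = along (remQuot-combine {suc r} {t} zero x) (remQuot-combine {suc r} {t} zero y)
    where
    along : ∀ {p q : Fin (suc r) × Fin t} → p ≡ (zero , x) → q ≡ (zero , y) →
            proj₁ p ≡ proj₁ q × (Next (proj₂ p) (proj₂ q) ⊎ Next (proj₂ q) (proj₂ p))
    along refl refl = refl , inj₁ xy

-- The limit

odd⇒5+2j : ∀ {t} → 5 ≤ t → 2 ∤ t → ∃[ j ] t ≡ 5 + j * 2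
odd⇒5+2j 5≤t 2∤t with m≤n⇒∃[o]m+o≡n 5≤t
... | s , refl with halve s 2∤t
  where
  halve : ∀ s → 2 ∤ 5 + s → ∃[ j ] s ≡ j * 2
  halve zero          _   = 0 , refl
  halve (suc zero)    2∤6 = contradiction (divides 3 refl) 2∤6
  halve (suc (suc s)) 2∤7+s with halve s (λ 2∣5+s → 2∤7+s (∣m∣n⇒∣m+n (∣-refl {2}) 2∣5+s))
  ... | j , refl = suc j , refl
...   | j , refl = j , refl

π-below : ∀ r h {ε} (3≤t : 3 ≤ suc (h * 2)) → 0ℚ ℚ.< ε →
          Cut.Below (π (suc r * suc (h * 2)) (copies (suc r) (cycle (suc (h * 2)) 3≤t))) (½ ℚ.- ε)
π-below r h 3≤t 0<ε = ½ , (toWitness {a? = 0ℚ ℚ.≤? ½} tt , toWitness {a? = ½ ℚ.≤? 1ℚ} tt ,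
  Bipartite.bipartite (suc r * suc (h * 2)) , Bipartite.½≤partiteDensity (suc r * suc (h * 2)) ,
  bipartite-no-traversal r h 3≤t) , ½-ε<½ 0<ε

π-above : ∀ r j {ε} (3≤t : 3 ≤ 5 + j * 2) → order-bound j (ℚ.↧ₙ ε) ≤ r → 0ℚ ℚ.< ε →
          Cut.Above (π (r * (5 + j * 2)) (copies r (cycle (5 + j * 2) 3≤t))) (½ ℚ.+ ε)
π-above r j {ε} 3≤t large 0<ε = threshold-above-½ (ℚ.↧ₙ ε) , bounded , threshold<½+ε 0<ε
  where
  bounded : ∀ a → (0ℚ ℚ.≤ a × a ℚ.≤ 1ℚ × ∃ λ (G : PartiteGraph (r * (5 + j * 2))) →
                   a ℚ.≤ partiteDensity G × ¬ HasTraversal (copies r (cycle (5 + j * 2) 3≤t)) G) →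
            a ℚ.≤ threshold-above-½ (ℚ.↧ₙ ε)
  -- Were `a` larger, its witness `G` would meet the density threshold and so have the traversal
  -- that it must lack.
  bounded a (_ , _ , G , a≤d , no-traversal) = ℚ.≮⇒≥ λ u<a →
    no-traversal (upper-bound r j (ℚ.↧ₙ ε) 3≤t large G (ℚ.≤-trans (ℚ.<⇒≤ u<a) a≤d))

π-limit : ∀ {t} j → t ≡ 5 + j * 2 → (3≤t : 3 ≤ t) → (λ r → π (r * t) (copies r (cycle t 3≤t))) ⟶ ½
-- The successor forces `r` to be positive, as the lower bound needs at least one copy.
π-limit {t} j refl 3≤t ε 0<ε = suc (order-bound j (ℚ.↧ₙ ε)) , beyond
  where
  beyond : ∀ r → suc (order-bound j (ℚ.↧ₙ ε)) ≤ r →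
           Cut.Below (π (r * t) (copies r (cycle t 3≤t))) (½ ℚ.- ε) ×
           Cut.Above (π (r * t) (copies r (cycle t 3≤t))) (½ ℚ.+ ε)
  -- For h = 2 + j, `suc (h * 2)` computes to `5 + j * 2`.
  beyond (suc r) large = π-below r (2 + j) 3≤t 0<ε , π-above (suc r) j 3≤t (<⇒≤ large) 0<ε

theorem1p6 : (t : ℕ) (7≤t : 7 ≤ t) → 2 ∤ t →
    (λ r → π (r * t) (copies r (cycle t (≤-trans (m≤n+m 3 4) 7≤t)))) ⟶ ½
theorem1p6 t 7≤t 2∤t = π-limit (proj₁ t≡5+j*2) (proj₂ t≡5+j*2) (≤-trans (m≤n+m 3 4) 7≤t)
  where
  t≡5+j*2 : ∃[ j ] t ≡ 5 + j * 2
  t≡5+j*2 = odd⇒5+2j (≤-trans (m≤n+m 5 2) 7≤t) 2∤t
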